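{- There is a linear function $f\colon\mathbb N\to\mathbb N$ such that for all $k\ge 2$ and all graphs $G,H$ we have \[ G\not\equiv^{\mathrm{PC}_k}H \ \Longrightarrow\ G\not\equiv^{f(k)}H. \]
   Context: Graphs are finite. $G\equiv^mH$ means that no sentence of infinitary counting logic $C^m_{\infty\omega}$ (infinitary first-order logic with counting quantifiers $\exists^{\ge i}x$ and at most $m$ variables) distinguishes $G$ and $H$. For graphs $G=(V,E)$, $H=(W,F)$, $\mathrm{ISO}(G,H)$ is the following system of polynomial equations over $\mathbb Q$ in variables $X[v\mapsto w]$, $v\in V,w\in W$: $X^2-X=0$ for each variable $X$; $\sum_{w\in W}X[v\mapsto w]=1$ for each $v\in V$; $\sum_{v\in V}X[v\mapsto w]=1$ for each $w\in W$; and $X[v_1\mapsto w_1]\cdot X[v_2\mapsto w_2]=0$ for all $v_1,v_2\in V$, $w_1,w_2\in W$ such that $(v_1,v_2)\in E$ if and only if $(w_1,w_2)\notin F$. $\mathrm{PC}_k$ is the polynomial calculus over $\mathbb Q$ of degree $k$: starting from the given polynomials (read as equations $p=0$), with rules: from $g$ infer $Xg$ for a variable $X$; from $g,h$ infer $ag+bh$ for $a,b\in\mathbb Q$; only polynomials of degree at most $k$ may occur (polynomials being implicitly multilinearised using $X^2-X=0$), with no restriction on coefficients. A refutation is a derivation of the constant polynomial $1$. $G\not\equiv^{\mathrm{PC}_k}H$ means that $\mathrm{ISO}(G,H)$ has a refutation in $\mathrm{PC}_k$. -}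

module Defs where

open import Data.Bool using (Bool; T; if_then_else_)
import Data.Bool.Properties as Bool
open import Data.Fin using (Fin; combine; _≟_)
open import Data.Fin.Subset using (Subset; _∈_; ⊥; ⁅_⁆; _∪_; _-_; ∣_∣)
open import Data.Fin.Subset.Properties using (x∈p∪q⁻; x∈⁅y⁆⇒x≡y; ∉⊥)
open import Data.Nat using (ℕ; _≤_)
import Data.Nat as ℕ
open import Data.Product using (Σ; ∃-syntax; _×_)
open import Data.Rational as ℚ using (ℚ; 0ℚ; 1ℚ)
open import Data.Sum using (_⊎_; [_,_]′)
open import Data.Vec using (lookup)
open import Data.Vec.Functional using (foldr)
import Data.Vec.Properties as Vec
open import Function.Bundles using (_⇔_; _↣_; Injection)
open import Relation.Binary.PropositionalEquality using (_≡_; _≢_)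
open import Relation.Nullary using (¬_; yes; no; does; contradiction)

IsLinear : (ℕ → ℕ) → Set
IsLinear f = ∃[ a ] ∃[ b ] (∀ k → f k ≡ a ℕ.* k ℕ.+ b)

-- The edge set is an arbitrary set of ordered pairs of vertices; simple
-- undirected graphs are the symmetric irreflexive ones.
record Graph : Set where
  field
    order : ℕ
    adj   : Fin order → Fin order → Bool

  V : Set
  V = Fin order

  Edge : V → V → Set
  Edge v w = T (adj v w)

open Graph public using (order; V; Edge)

-- Formulas of C^m_∞ω over the variables Fin m, all of whose free variables
-- lie in S.  A variable may be requantified inside its own scope.
data Formula (m : ℕ) (S : Subset m) : Set₁ where
  eq   : (x y : Fin m) → x ∈ S → y ∈ S → Formula m S
  edge : (x y : Fin m) → x ∈ S → y ∈ S → Formula m S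
  neg  : Formula m S → Formula m S
  ⋀ ⋁  : (I : Set) → (I → Formula m S) → Formula m S
  ∃≥   : (i : ℕ) (x : Fin m) → Formula m (⁅ x ⁆ ∪ S) → Formula m S

Sentence : ℕ → Set₁
Sentence m = Formula m ⊥

-- Only the variables in S receive a value, so that sentences can also be
-- evaluated in the graph without vertices.
Assignment : (m : ℕ) → Subset m → Set → Set
Assignment m S A = (x : Fin m) → x ∈ S → A

module _ {m : ℕ} {S : Subset m} {A : Set} where

  _[_↦_] : Assignment m S A → (x : Fin m) → A → Assignment m (⁅ x ⁆ ∪ S) A
  (ρ [ x ↦ a ]) y y∈ with y ≟ x
  ... | yes _   = a
  ... | no  y≢x = [ (λ y∈⁅x⁆ → contradiction (x∈⁅y⁆⇒x≡y x y∈⁅x⁆) y≢x) , ρ y ]′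
                  (x∈p∪q⁻ ⁅ x ⁆ S y∈)

Sat : (G : Graph) {m : ℕ} {S : Subset m} →
      Assignment m S (V G) → Formula m S → Set
Sat G ρ (eq x y x∈ y∈)   = ρ x x∈ ≡ ρ y y∈
Sat G ρ (edge x y x∈ y∈) = Edge G (ρ x x∈) (ρ y y∈)
Sat G ρ (neg φ)          = ¬ Sat G ρ φ
Sat G ρ (⋀ I φ)          = (i : I) → Sat G ρ (φ i)
Sat G ρ (⋁ I φ)          = Σ I λ i → Sat G ρ (φ i)
Sat G ρ (∃≥ i x φ)       =
  Σ (Fin i ↣ V G) λ e → (j : Fin i) → Sat G (ρ [ x ↦ Injection.to e j ]) φ

_⊨_ : Graph → {m : ℕ} → Sentence m → Set
G ⊨ φ = Sat G (λ x x∈⊥ → contradiction x∈⊥ ∉⊥) φ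

Distinguishes : {m : ℕ} → Sentence m → Graph → Graph → Set
Distinguishes φ G H = (G ⊨ φ × ¬ (H ⊨ φ)) ⊎ (H ⊨ φ × ¬ (G ⊨ φ))

_≡C[_]_ : Graph → ℕ → Graph → Set₁
G ≡C[ m ] H = ¬ (∃[ φ ] Distinguishes {m} φ G H)

_≢C[_]_ : Graph → ℕ → Graph → Set₁
G ≢C[ m ] H = ¬ (G ≡C[ m ] H)

-- The monomial ∏_{x ∈ S} x is represented by S, and a polynomial by its
-- coefficients.  These are the normal forms modulo the polynomials x² - x.
Poly : ℕ → Set
Poly N = Subset N → ℚ

module _ {N : ℕ} where

  infix  4 _≈_
  infixl 6 _-ₚ_
  infixr 7 _·_ _∙_

  _≈_ : Poly N → Poly N → Set
  p ≈ q = ∀ S → p S ≡ q S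

  monomial : Subset N → Poly N
  monomial M S = if does (Vec.≡-dec Bool._≟_ M S) then 1ℚ else 0ℚ

  1ₚ : Poly N
  1ₚ = monomial ⊥

  var : Fin N → Poly N
  var x = monomial ⁅ x ⁆

  _+ₚ_ : Poly N → Poly N → Poly N
  (p +ₚ q) S = p S ℚ.+ q S

  _-ₚ_ : Poly N → Poly N → Poly N
  (p -ₚ q) S = p S ℚ.- q S

  _·_ : ℚ → Poly N → Poly N
  (a · p) S = a ℚ.* p S

  -- Product with a variable followed by multilinearisation: the monomials T
  -- with T ∪ ⁅ x ⁆ ≡ S are S and S - x if x ∈ S, and there are none otherwise.
  _∙_ : Fin N → Poly N → Poly N
  (x ∙ p) S = if lookup S x then p S ℚ.+ p (S - x) else 0ℚ

  sumₚ : {n : ℕ} → (Fin n → Poly N) → Poly N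
  sumₚ f S = foldr ℚ._+_ 0ℚ (λ i → f i S)

  Degree≤ : ℕ → Poly N → Set
  Degree≤ k p = ∀ S → p S ≢ 0ℚ → ∣ S ∣ ≤ k

-- The polynomials derivable in PC_k from Ax.  A linear combination of
-- polynomials of degree at most k again has degree at most k.  The last
-- constructor identifies polynomials with equal coefficients.
data PC {N : ℕ} (k : ℕ) (Ax : Poly N → Set) : Poly N → Set where
  axiom : ∀ {p} → Ax p → Degree≤ k p → PC k Ax p
  mult  : ∀ {g} (x : Fin N) → PC k Ax g → Degree≤ k (x ∙ g) → PC k Ax (x ∙ g)
  lin   : ∀ {g h} (a b : ℚ) → PC k Ax g → PC k Ax h →
          PC k Ax ((a · g) +ₚ (b · h))
  resp  : ∀ {g h} → g ≈ h → PC k Ax g → PC k Ax h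

Refutation : {N : ℕ} → ℕ → (Poly N → Set) → Set
Refutation k Ax = PC k Ax 1ₚ

module _ (G H : Graph) where

  numVars : ℕ
  numVars = order G ℕ.* order H

  X[_↦_] : V G → V H → Fin numVars
  X[ v ↦ w ] = combine v w

  -- The left-hand sides p of the equations p = 0.
  data ISO : Poly numVars → Set where
    boolean : ∀ v w → ISO (X[ v ↦ w ] ∙ var X[ v ↦ w ] -ₚ var X[ v ↦ w ])
    row     : ∀ v → ISO (sumₚ (λ w → var X[ v ↦ w ]) -ₚ 1ₚ)
    column  : ∀ w → ISO (sumₚ (λ v → var X[ v ↦ w ]) -ₚ 1ₚ)
    compat  : ∀ v₁ v₂ w₁ w₂ → (Edge G v₁ v₂ ⇔ (¬ Edge H w₁ w₂)) →
              ISO (X[ v₁ ↦ w₁ ] ∙ var X[ v₂ ↦ w₂ ])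

_≢PC[_]_ : Graph → ℕ → Graph → Set
G ≢PC[ k ] H = Refutation k (ISO G H)

{-# OPTIONS --safe #-}

-- Suppose that G and H are not distinguished.  Call tuples of vertices of G or
-- H equivalent if they have the same stable colour; the adjacency matrices of
-- the colours then span isomorphic algebras for G and H.  Let ℓ(x , y), the
-- pseudo-expectation of ∏ X[ xᵢ ↦ yᵢ ], be the inverse of the size of the class
-- of x if x ~ y, and 0 otherwise.  The polynomials p of degree at most k with
-- ℓ(m p) = 0 for all monomials m of degree at most k contain ISO(G , H) but not
-- 1.  They are closed under multiplication with variables if ℓ(m p) = 0 still
-- holds for deg m = k + 1.  Now ℓ is a Casimir element: counting triangles gives
--   ∑_{x′} ℓ(x′x , y′y) ℓ(x′a , y′b) = ∑_z ℓ(xa , zb) Z(y′ , y , z),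
-- and therefore ∑_m ℓ(m p)² is a combination of values ℓ(m′ p) = 0 with
-- deg m′ ≤ k.  So each square vanishes.
module Submission where

open import Defs
open import Data.Nat using (ℕ; _≤_)
open import Data.Product using (∃-syntax; _×_)

open import Data.Bool using (Bool; true; false; T; if_then_else_)
import Data.Bool.Properties as Bool
open import Data.Fin as Fin
  using (Fin; zero; suc; toℕ; fromℕ<; inject≤; _↑ˡ_; _↑ʳ_; quotient; remainder)
import Data.Fin.Properties as Fin
open import Data.Fin.Subset as Subset using (Subset; ⁅_⁆; _∪_; _∈_; ∣_∣)
open import Data.Fin.Subset.Properties
  using (x∈p∪q⁻; x∈p∪q⁺; x∈⁅y⁆⇒x≡y; x∈⁅x⁆; ∉⊥; ∪-identityʳ; p─⊥≡p; ∣⊥∣≡0; ∣⁅x⁆∣≡1)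
open import Data.List as List
  using (List; []; _∷_; allFin; cartesianProductWith; concatMap; filter; length; upTo)
import Data.List.Membership.Propositional as List
open import Data.List.Membership.Propositional.Properties
  using (∈-allFin; ∈-cartesianProductWith⁺; ∈-concatMap⁺; ∈-filter⁺; ∈-filter⁻; ∈-upTo⁺)
  renaming (∈-lookup to ∈-lookupˡ)
import Data.List.Properties as List
import Data.List.Relation.Unary.All as All
open import Data.List.Relation.Unary.All.Properties using (¬All⇒Any¬)
open import Data.List.Relation.Unary.AllPairs using (_∷_)
open import Data.List.Relation.Unary.Any using (here; there; index)
open import Data.List.Relation.Unary.Any.Properties using (lookup-index)
open import Data.List.Relation.Unary.Unique.Propositional using (Unique)
import Data.List.Relation.Unary.Unique.Propositional.Properties as Unique
open import Data.Nat as ℕ using (zero; suc; _<_; s≤s; z≤n)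
import Data.Nat.Properties as ℕ
open import Data.Product using (Σ; _,_; proj₁; proj₂)
open import Data.Rational as ℚ using (ℚ; 0ℚ; 1ℚ; _+_; _*_)
import Data.Rational.Properties as ℚ
open import Data.Rational.Solver using (module +-*-Solver)
open import Data.Sum using (inj₁; inj₂)
open import Data.Vec as Vec using (Vec; []; _∷_; _++_; lookup; here; there)
import Data.Vec.Membership.Propositional as Vec
open import Data.Vec.Membership.Propositional.Properties
  using (∈-lookup; ∈-map⁺; ∈-++⁺ˡ; ∈-++⁺ʳ; fromAny)
import Data.Vec.Properties as Vec
import Data.Vec.Relation.Unary.Any as VecAny
import Data.Vec.Relation.Unary.Any.Properties as VecAny
open import Function using (_∘_; id)
open import Function.Bundles using (_⇔_; mk⇔; _↣_; mk↣; Equivalence; Injection)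
open import Relation.Binary.PropositionalEquality
open import Relation.Nullary using (¬_; Dec; yes; no; does; contradiction; ¬?)
open import Relation.Nullary.Decidable using (map′; _×-dec_; dec-true; dec-false)
open Equivalence using (to; from)
open ≡-Reasoning

-- If G and H were isomorphic and the colours were orbits, ℓ(x , y) would be the probability that a
-- uniformly random isomorphism takes x to y; hence the inverse class sizes. In matrix terms, the
-- adjacency matrix A(c) of a colour c has squared norm |c| for the trace form, so ℓ is the sum of
-- A(c) ⊗ A(c) / |c|: a basis paired with its dual basis.
--
-- The obstacle is multiplication. ℓ(m · xp) = ℓ(mx · p), so each use of `mult` costs one degree of
-- test monomials. Cancellation and multilinearity keep the degree of the polynomial at most k, and
-- a derivation may multiply arbitrarily often. Starting with test monomials of some larger fixed
-- degree would only delay the loss; the lost degree has to be regained after every multiplication.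
-- The order of ℚ makes this possible: a sum of squares vanishes only if each of its terms does.

private variable
  A B C P Q : Set

-- Finite sums and division in ℚ.

∑ : List A → (A → ℚ) → ℚ
∑ []       f = 0ℚ
∑ (x ∷ xs) f = f x + ∑ xs f

∑-cong : ∀ (xs : List A) {f g} → (∀ x → f x ≡ g x) → ∑ xs f ≡ ∑ xs g
∑-cong []       h = refl
∑-cong (x ∷ xs) h = cong₂ _+_ (h x) (∑-cong xs h)

∑-0 : ∀ (xs : List A) → ∑ xs (λ _ → 0ℚ) ≡ 0ℚ
∑-0 []       = refl
∑-0 (x ∷ xs) = trans (ℚ.+-identityˡ _) (∑-0 xs)

∑-zero : ∀ (xs : List A) {f} → (∀ x → f x ≡ 0ℚ) → ∑ xs f ≡ 0ℚ
∑-zero xs h = trans (∑-cong xs h) (∑-0 xs)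

interchange : ∀ a b c d → (a + b) + (c + d) ≡ (a + c) + (b + d)
interchange = solve 4 (λ a b c d → (a :+ b) :+ (c :+ d) := (a :+ c) :+ (b :+ d)) refl
  where open +-*-Solver

∑-+ : ∀ (xs : List A) f g → ∑ xs (λ x → f x + g x) ≡ ∑ xs f + ∑ xs g
∑-+ []       f g = refl
∑-+ (x ∷ xs) f g = trans (cong (f x + g x +_) (∑-+ xs f g)) (interchange (f x) (g x) _ _)

∑-*ˡ : ∀ (xs : List A) c f → ∑ xs (λ x → c * f x) ≡ c * ∑ xs f
∑-*ˡ []       c f = sym (ℚ.*-zeroʳ c)
∑-*ˡ (x ∷ xs) c f = trans (cong (c * f x +_) (∑-*ˡ xs c f)) (sym (ℚ.*-distribˡ-+ c _ _))

∑-*ʳ : ∀ (xs : List A) f c → ∑ xs (λ x → f x * c) ≡ ∑ xs f * c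
∑-*ʳ xs f c = trans (∑-cong xs λ x → ℚ.*-comm (f x) c) (trans (∑-*ˡ xs c f) (ℚ.*-comm c _))

∑-swap : ∀ (xs : List A) (ys : List B) (f : A → B → ℚ) →
         ∑ xs (λ x → ∑ ys (f x)) ≡ ∑ ys (λ y → ∑ xs (λ x → f x y))
∑-swap []       ys f = sym (∑-0 ys)
∑-swap (x ∷ xs) ys f = trans (cong (∑ ys (f x) +_) (∑-swap xs ys f)) (sym (∑-+ ys (f x) _))

∑-++ : ∀ (xs ys : List A) f → ∑ (xs List.++ ys) f ≡ ∑ xs f + ∑ ys f
∑-++ []       ys f = sym (ℚ.+-identityˡ _)
∑-++ (x ∷ xs) ys f = trans (cong (f x +_) (∑-++ xs ys f)) (sym (ℚ.+-assoc (f x) _ _))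

∑-map : ∀ (g : A → B) xs f → ∑ (List.map g xs) f ≡ ∑ xs (f ∘ g)
∑-map g []       f = refl
∑-map g (x ∷ xs) f = cong (f (g x) +_) (∑-map g xs f)

∑-product : ∀ (_⋆_ : A → B → C) xs ys f →
            ∑ (cartesianProductWith _⋆_ xs ys) f ≡ ∑ xs (λ x → ∑ ys (λ y → f (x ⋆ y)))
∑-product _⋆_ []       ys f = refl
∑-product _⋆_ (x ∷ xs) ys f =
  trans (∑-++ (List.map (x ⋆_) ys) _ f)
        (cong₂ _+_ (∑-map (x ⋆_) ys f) (∑-product _⋆_ xs ys f))

∑-nonNeg : ∀ (xs : List A) {f} → (∀ x → 0ℚ ℚ.≤ f x) → 0ℚ ℚ.≤ ∑ xs f
∑-nonNeg []       pos = ℚ.≤-refl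
∑-nonNeg (x ∷ xs) pos = ℚ.+-mono-≤ (pos x) (∑-nonNeg xs pos)

≤-∑ : ∀ {xs : List A} {f x} → (∀ y → 0ℚ ℚ.≤ f y) → x List.∈ xs → f x ℚ.≤ ∑ xs f
≤-∑ {xs = y ∷ xs} {f} pos (here refl) = subst (ℚ._≤ f y + ∑ xs f) (ℚ.+-identityʳ (f y))
  (ℚ.+-monoʳ-≤ (f y) (∑-nonNeg xs pos))
≤-∑ {xs = y ∷ xs} {f} {x} pos (there x∈) = subst (ℚ._≤ f y + ∑ xs f) (ℚ.+-identityˡ (f x))
  (ℚ.+-mono-≤ (pos y) (≤-∑ pos x∈))

∑≡0⇒≡0 : ∀ {xs : List A} {f x} → (∀ y → 0ℚ ℚ.≤ f y) → ∑ xs f ≡ 0ℚ → x List.∈ xs → f x ≡ 0ℚ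
∑≡0⇒≡0 {x = x} pos h x∈ = ℚ.≤-antisym (subst (_ ℚ.≤_) h (≤-∑ pos x∈)) (pos x)

square-nonNeg : ∀ q → 0ℚ ℚ.≤ q * q
square-nonNeg q with ℚ.≤-total 0ℚ q
... | inj₁ 0≤q = subst (ℚ._≤ q * q) (ℚ.*-zeroˡ q) (ℚ.*-monoʳ-≤-nonNeg q {{ℚ.nonNegative 0≤q}} 0≤q)
... | inj₂ q≤0 = subst (ℚ._≤ q * q) (ℚ.*-zeroˡ q) (ℚ.*-monoʳ-≤-nonPos q {{ℚ.nonPositive q≤0}} q≤0)

-- The value at 0 is junk.
inv : ℚ → ℚ
inv q with q ℚ.≟ 0ℚ
... | yes _  = 0ℚ
... | no q≢0 = ℚ.1/_ q {{ℚ.≢-nonZero q≢0}}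

inv-inverse : ∀ {q} → q ≢ 0ℚ → q * inv q ≡ 1ℚ
inv-inverse {q} q≢0 with q ℚ.≟ 0ℚ
... | yes q≡0 = contradiction q≡0 q≢0
... | no q≢0′ = ℚ.*-inverseʳ q {{ℚ.≢-nonZero q≢0′}}

*-cancelˡ-≢0 : ∀ {a b c} → a ≢ 0ℚ → a * b ≡ a * c → b ≡ c
*-cancelˡ-≢0 {a} {b} {c} a≢0 h = trans (sym (undo b)) (trans (cong (inv a *_) h) (undo c))
  where
  undo : ∀ x → inv a * (a * x) ≡ x
  undo x = begin
    inv a * (a * x) ≡⟨ ℚ.*-assoc (inv a) a x ⟨
    (inv a * a) * x ≡⟨ cong (_* x) (trans (ℚ.*-comm (inv a) a) (inv-inverse a≢0)) ⟩
    1ℚ * x          ≡⟨ ℚ.*-identityˡ x ⟩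
    x               ∎

square≡0⇒≡0 : ∀ q → q * q ≡ 0ℚ → q ≡ 0ℚ
square≡0⇒≡0 q h with q ℚ.≟ 0ℚ
... | yes q≡0 = q≡0
... | no q≢0  = *-cancelˡ-≢0 q≢0 (trans h (sym (ℚ.*-zeroʳ q)))

-- Indicator functions, counting, and enumerations of finite types.

𝟙 : Dec P → ℚ
𝟙 d = if does d then 1ℚ else 0ℚ

𝟙-true : (d : Dec P) → P → 𝟙 d ≡ 1ℚ
𝟙-true d p = cong (if_then 1ℚ else 0ℚ) (dec-true d p)

𝟙-false : (d : Dec P) → ¬ P → 𝟙 d ≡ 0ℚ
𝟙-false d ¬p = cong (if_then 1ℚ else 0ℚ) (dec-false d ¬p)

𝟙-nonNeg : (d : Dec P) → 0ℚ ℚ.≤ 𝟙 d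
𝟙-nonNeg (yes _) = ℚ.<⇒≤ (ℚ.positive⁻¹ 1ℚ)
𝟙-nonNeg (no _)  = ℚ.≤-refl

𝟙-cong : (d : Dec P) (e : Dec Q) → (P → Q) → (Q → P) → 𝟙 d ≡ 𝟙 e
𝟙-cong (yes p) e to from = sym (𝟙-true e (to p))
𝟙-cong (no ¬p) e to from = sym (𝟙-false e (¬p ∘ from))

𝟙-*-cong : (d : Dec P) {a b : ℚ} → (P → a ≡ b) → 𝟙 d * a ≡ 𝟙 d * b
𝟙-*-cong (yes p) h = cong (1ℚ *_) (h p)
𝟙-*-cong (no _) {a} {b} _ = trans (ℚ.*-zeroˡ a) (sym (ℚ.*-zeroˡ b))

∑𝟙≢0 : ∀ {xs : List A} {P : A → Set} (P? : ∀ x → Dec (P x)) {x} → x List.∈ xs → P x →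
       ∑ xs (λ x → 𝟙 (P? x)) ≢ 0ℚ
∑𝟙≢0 {xs = xs} P? {x} x∈ px h with
  () ← trans (sym (𝟙-true (P? x) px)) (∑≡0⇒≡0 {xs = xs} (λ y → 𝟙-nonNeg (P? y)) h x∈)

fromℕ : ℕ → ℚ
fromℕ zero    = 0ℚ
fromℕ (suc n) = 1ℚ + fromℕ n

∑𝟙≡length : ∀ (xs : List A) {P : A → Set} (P? : ∀ x → Dec (P x)) →
            ∑ xs (λ x → 𝟙 (P? x)) ≡ fromℕ (length (filter P? xs))
∑𝟙≡length []       P? = refl
∑𝟙≡length (x ∷ xs) P? with P? x
... | yes _ = cong (1ℚ +_) (∑𝟙≡length xs P?)
... | no  _ = trans (ℚ.+-identityˡ _) (∑𝟙≡length xs P?)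

-- Says that every element of `A` occurs exactly once in `xs`, in the form in which sums use it.
SumsDeltas : List A → Set
SumsDeltas {A} xs = ∀ (f : A → ℚ) a → (∀ b → b ≢ a → f b ≡ 0ℚ) → ∑ xs f ≡ f a

∑-allFin-suc : ∀ n f → ∑ (allFin (suc n)) f ≡ f zero + ∑ (allFin n) (f ∘ suc)
∑-allFin-suc n f = cong (f zero +_) (tabulate-suc id)
  where
  tabulate-suc : ∀ {m} (g : Fin m → Fin n) →
                 ∑ (List.tabulate (suc ∘ g)) f ≡ ∑ (List.tabulate g) (f ∘ suc)
  tabulate-suc {zero}  g = refl
  tabulate-suc {suc m} g = cong (f (suc (g zero)) +_) (tabulate-suc (g ∘ suc))

allFin-deltas : ∀ n → SumsDeltas (allFin n)
allFin-deltas (suc n) f zero f≡0 = begin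
  ∑ (allFin (suc n)) f             ≡⟨ ∑-allFin-suc n f ⟩
  f zero + ∑ (allFin n) (f ∘ suc)  ≡⟨ cong (f zero +_) (∑-zero (allFin n) λ b → f≡0 (suc b) λ ()) ⟩
  f zero + 0ℚ                      ≡⟨ ℚ.+-identityʳ (f zero) ⟩
  f zero                           ∎
allFin-deltas (suc n) f (suc a) f≡0 = begin
  ∑ (allFin (suc n)) f             ≡⟨ ∑-allFin-suc n f ⟩
  f zero + ∑ (allFin n) (f ∘ suc)  ≡⟨ cong₂ _+_ (f≡0 zero λ ())
                                        (allFin-deltas n (f ∘ suc) a λ b b≢a →
                                          f≡0 (suc b) λ { refl → b≢a refl }) ⟩
  0ℚ + f (suc a)                   ≡⟨ ℚ.+-identityˡ _ ⟩
  f (suc a)                        ∎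

vecs : List A → ∀ d → List (Vec A d)
vecs xs zero    = [] ∷ []
vecs xs (suc d) = cartesianProductWith _∷_ xs (vecs xs d)

∈-vecs : ∀ {xs : List A} → (∀ a → a List.∈ xs) → ∀ {d} (v : Vec A d) → v List.∈ vecs xs d
∈-vecs all []      = here refl
∈-vecs all (a ∷ v) = ∈-cartesianProductWith⁺ _∷_ (all a) (∈-vecs all v)

∑-vecs-suc : ∀ (xs : List A) d f →
             ∑ (vecs xs (suc d)) f ≡ ∑ xs (λ a → ∑ (vecs xs d) (λ v → f (a ∷ v)))
∑-vecs-suc xs d = ∑-product _∷_ xs (vecs xs d)

vecs-deltas : ∀ {xs : List A} → SumsDeltas xs → ∀ d → SumsDeltas (vecs xs d)
vecs-deltas δ zero f [] _ = ℚ.+-identityʳ (f [])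
vecs-deltas {xs = xs} δ (suc d) f (a ∷ v) f≡0 = begin
  ∑ (vecs xs (suc d)) f                     ≡⟨ ∑-vecs-suc xs d f ⟩
  ∑ xs (λ b → ∑ (vecs xs d) (f ∘ (b ∷_)))   ≡⟨ δ _ a (λ b b≢a → ∑-zero (vecs xs d) λ u →
                                                 f≡0 (b ∷ u) λ { refl → b≢a refl }) ⟩
  ∑ (vecs xs d) (f ∘ (a ∷_))                ≡⟨ vecs-deltas δ d _ v (λ u u≢v →
                                                 f≡0 (a ∷ u) λ { refl → u≢v refl }) ⟩
  f (a ∷ v)                                 ∎

bools : List Bool
bools = true ∷ false ∷ []

∈-bools : ∀ b → b List.∈ bools
∈-bools true  = here refl
∈-bools false = there (here refl)

bools-deltas : SumsDeltas bools
bools-deltas f true  f≡0 = trans (cong (λ q → f true + (q + 0ℚ)) (f≡0 false λ ())) (ℚ.+-identityʳ _)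
bools-deltas f false f≡0 = trans (cong (_+ (f false + 0ℚ)) (f≡0 true λ ()))
                                 (trans (ℚ.+-identityˡ _) (ℚ.+-identityʳ _))

-- Counting witnesses, deciding universal statements, and fresh variables over finite sets.

lookup-injective : ∀ {A : Set} {xs : List A} → Unique xs → ∀ i j →
                   List.lookup xs i ≡ List.lookup xs j → i ≡ j
lookup-injective (_ ∷ _)    zero    zero    _  = refl
lookup-injective (x∉ ∷ _)   zero    (suc j) h = contradiction h (All.lookup x∉ (∈-lookupˡ j))
lookup-injective (x∉ ∷ _)   (suc i) zero    h = contradiction (sym h) (All.lookup x∉ (∈-lookupˡ i))
lookup-injective (_ ∷ uniq) (suc i) (suc j) h = cong suc (lookup-injective uniq i j h)

module _ {n : ℕ} {P : Fin n → Set} (P? : ∀ a → Dec (P a)) where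

  -- Turns the semantics of `∃≥ i`, an injection from `Fin i`, into a comparison of cardinalities.
  witnesses⇔≤count : ∀ i → (Σ (Fin i ↣ Fin n) λ e → ∀ j → P (Injection.to e j)) ⇔
                           (i ≤ length (filter P? (allFin n)))
  witnesses⇔≤count i = mk⇔ bound choose
    where
    bound : (Σ (Fin i ↣ Fin n) λ e → ∀ j → P (Injection.to e j)) → i ≤ length (filter P? (allFin n))
    bound (e , pe) = Fin.injective⇒≤ {f = index ∘ position} λ {j} {k} h →
      Injection.injective e
        (trans (lookup-index (position j))
          (trans (cong (List.lookup (filter P? (allFin n))) h) (sym (lookup-index (position k)))))
      where
      position : ∀ j → Injection.to e j List.∈ filter P? (allFin n)
      position j = ∈-filter⁺ P? (∈-allFin _) (pe j)
    choose : i ≤ length (filter P? (allFin n)) → Σ (Fin i ↣ Fin n) λ e → ∀ j → P (Injection.to e j)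
    choose i≤ =
      mk↣ {to = λ j → List.lookup (filter P? (allFin n)) (inject≤ j i≤)}
          (λ h → Fin.inject≤-injective i≤ i≤ _ _
                    (lookup-injective (Unique.filter⁺ P? (Unique.allFin⁺ n)) _ _ h)) ,
      λ j → proj₂ (∈-filter⁻ P? {xs = allFin n} (∈-lookupˡ (inject≤ j i≤)))

allVec? : ∀ {n} d {P : Vec (Fin n) d → Set} → (∀ v → Dec (P v)) → Dec (∀ v → P v)
allVec? zero    P? = map′ (λ { p [] → p }) (λ p → p []) (P? [])
allVec? (suc d) P? = map′ (λ { p (a ∷ v) → p a v }) (λ p a v → p (a ∷ v))
                          (Fin.all? λ a → allVec? d λ v → P? (a ∷ v))

allBool? : {P : Bool → Set} → (∀ b → Dec (P b)) → Dec (∀ b → P b)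
allBool? P? = map′ (λ { (t , f) true → t ; (t , f) false → f }) (λ p → p true , p false)
                   (P? true ×-dec P? false)

fresh : ∀ {e m} → e < m → (ν : Vec (Fin m) e) → ∃[ y ] (∀ i → lookup ν i ≢ y)
fresh {e} {m} e<m ν with Fin.any? (λ y → Fin.all? (λ i → ¬? (lookup ν i Fin.≟ y)))
... | yes found = found
... | no  ¬found = contradiction (Fin.injective⇒≤ {f = proj₁ ∘ hit} injective) (ℕ.<⇒≱ e<m)
  where
  hit : ∀ y → ∃[ i ] lookup ν i ≡ y
  hit y with Fin.any? (λ i → lookup ν i Fin.≟ y)
  ... | yes p = p
  ... | no ¬p = contradiction (y , λ i h → ¬p (i , h)) ¬found
  injective : ∀ {y z} → proj₁ (hit y) ≡ proj₁ (hit z) → y ≡ z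
  injective {y} {z} h = trans (sym (proj₂ (hit y))) (trans (cong (lookup ν) h) (proj₂ (hit z)))

sel : ∀ {A : Set} {d e} → Vec A d → Vec (Fin d) e → Vec A e
sel x = Vec.map (lookup x)

lookup-sel : ∀ {A : Set} {d e} (x : Vec A d) (π : Vec (Fin d) e) i →
             lookup (sel x π) i ≡ lookup x (lookup π i)
lookup-sel x π i = Vec.lookup-map i (lookup x) π

-- Colour refinement of tuples and its definability in counting logic.

module Refinement (𝒢 : Bool → Graph) (M : ℕ) where

  m : ℕ
  m = suc M

  private variable
    s t u : Bool
    d e : ℕ

  Tuple : Bool → ℕ → Set
  Tuple s d = Vec (V (𝒢 s)) d

  eqᵇ adjᵇ : Tuple s d → Fin d → Fin d → Bool
  eqᵇ x i j = does (lookup x i Fin.≟ lookup x j)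
  adjᵇ {s} x i j = Graph.adj (𝒢 s) (lookup x i) (lookup x j)

  rel  : ℕ → Tuple s d → Tuple t d → Set
  rel? : ∀ r (x : Tuple s d) (y : Tuple t d) → Dec (rel r x y)
  -- Colours have no names of their own: the colour of an extension is given by a representative
  -- `z`, which may lie in either graph.
  count : ℕ → Tuple s d → Tuple t (suc d) → ℕ

  -- Unlike in the usual colour refinement, the substitutions x ↦ sel x π are
  -- built into the refinement step: ~-⊑ below depends on it.
  rel zero x y = ∀ i j → eqᵇ x i j ≡ eqᵇ y i j × adjᵇ x i j ≡ adjᵇ y i j
  rel {d = d} (suc r) x y =
    rel r x y ×
    (∀ (e : Fin m) (π : Vec (Fin d) (toℕ e)) →
       rel r (sel x π) (sel y π) ×
       (∀ u (z : Tuple u (suc (toℕ e))) → count r (sel x π) z ≡ count r (sel y π) z))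

  rel? zero x y = Fin.all? λ i → Fin.all? λ j →
    (eqᵇ x i j Bool.≟ eqᵇ y i j) ×-dec (adjᵇ x i j Bool.≟ adjᵇ y i j)
  rel? (suc r) x y =
    rel? r x y ×-dec
    (Fin.all? λ e → allVec? (toℕ e) λ π →
       rel? r (sel x π) (sel y π) ×-dec
       (allBool? λ u → allVec? (suc (toℕ e)) λ z → count r (sel x π) z ℕ.≟ count r (sel y π) z))

  count r x z = length (filter (λ a → rel? r (a ∷ x) z) (allFin _))

  literal : {S : Subset m} → Bool → Formula m S → Formula m S
  literal true  φ = φ
  literal false φ = neg φ

  exactly : {S : Subset m} → ℕ → (y : Fin m) → Formula m (⁅ y ⁆ ∪ S) → Formula m S
  exactly c y φ = ⋀ Bool λ { true → ∃≥ c y φ ; false → neg (∃≥ (suc c) y φ) }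

  Within : Vec (Fin m) d → Subset m → Set
  Within ν S = ∀ i → lookup ν i ∈ S

  within-sel : ∀ {S} (ν : Vec (Fin m) d) → Within ν S → (π : Vec (Fin d) e) → Within (sel ν π) S
  within-sel {S = S} ν ν∈ π i = subst (_∈ S) (sym (lookup-sel ν π i)) (ν∈ (lookup π i))

  within-∷ : ∀ {S} {ν : Vec (Fin m) d} → Within ν S → ∀ y → Within (y ∷ ν) (⁅ y ⁆ ∪ S)
  within-∷ ν∈ y zero    = x∈p∪q⁺ (inj₁ (x∈⁅x⁆ y))
  within-∷ ν∈ y (suc i) = x∈p∪q⁺ (inj₂ (ν∈ i))

  -- This is where m = M + 1 comes from: at most M names are in use, so one variable is left for the
  -- quantifier. Names outside the selection are not mentioned in its scope and may be overwritten.
  freshFor : (e : Fin m) (ν : Vec (Fin m) (toℕ e)) → ∃[ y ] (∀ i → lookup ν i ≢ y)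
  freshFor e = fresh (Fin.toℕ<n e)

  -- The variables ν name the entries of the tuple; they may repeat.
  char : ∀ (r : ℕ) (z : Tuple s d) {S} (ν : Vec (Fin m) d) → Within ν S → Formula m S
  char {d = d} zero z ν ν∈ = ⋀ (Fin d × Fin d) λ (i , j) → ⋀ Bool λ where
    true  → literal (eqᵇ z i j) (eq (lookup ν i) (lookup ν j) (ν∈ i) (ν∈ j))
    false → literal (adjᵇ z i j) (edge (lookup ν i) (lookup ν j) (ν∈ i) (ν∈ j))
  char {d = d} (suc r) z ν ν∈ = ⋀ Bool λ where
    true  → char r z ν ν∈
    false → ⋀ (Σ (Fin m) λ e → Vec (Fin d) (toℕ e)) λ (e , π) → ⋀ Bool λ where
      true  → char r (sel z π) (sel ν π) (within-sel ν ν∈ π)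
      false → ⋀ (Σ Bool λ u → Tuple u (suc (toℕ e))) λ (u , z′) →
        let y = proj₁ (freshFor e (sel ν π)) in
        exactly (count r (sel z π) z′) y
                (char r z′ (y ∷ sel ν π) (within-∷ (within-sel ν ν∈ π) y))

  Names : ∀ {S} → Assignment m S (V (𝒢 t)) → Vec (Fin m) d → Tuple t d → Set
  Names ρ ν x = ∀ i p → ρ (lookup ν i) p ≡ lookup x i

  names-sel : ∀ {S} (ρ : Assignment m S (V (𝒢 t))) (ν : Vec (Fin m) d) x → Names ρ ν x →
              (π : Vec (Fin d) e) → Names ρ (sel ν π) (sel x π)
  names-sel ρ ν x names π i p rewrite lookup-sel ν π i | lookup-sel x π i =
    names (lookup π i) p

  names-∷ : ∀ {S} (ρ : Assignment m S (V (𝒢 t))) (ν : Vec (Fin m) d) x {y} → Names ρ ν x →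
            (∀ i → lookup ν i ≢ y) → ∀ a → Names (ρ [ y ↦ a ]) (y ∷ ν) (a ∷ x)
  names-∷ ρ ν x {y} names y∉ a zero p with y Fin.≟ y
  ... | yes _  = refl
  ... | no y≢y = contradiction refl y≢y
  names-∷ {S = S} ρ ν x {y} names y∉ a (suc i) p with lookup ν i Fin.≟ y
  ... | yes ν≡y = contradiction ν≡y (y∉ i)
  ... | no  _ with x∈p∪q⁻ ⁅ y ⁆ S p
  ...   | inj₁ q = contradiction (x∈⁅y⁆⇒x≡y y q) (y∉ i)
  ...   | inj₂ q = names i q

  literal-eq : ∀ {S} {ρ : Assignment m S (V (𝒢 t))} {φ} {A : Set} (b : Bool) (a? : Dec A) →
               (Sat (𝒢 t) ρ φ ⇔ A) → Sat (𝒢 t) ρ (literal b φ) ⇔ (does a? ≡ b)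
  literal-eq true (yes a) φ⇔a = mk⇔ (λ _ → refl) (λ _ → from φ⇔a a)
  literal-eq true (no ¬a) φ⇔a = mk⇔ (λ φ → contradiction (to φ⇔a φ) ¬a) λ ()
  literal-eq false (yes a) φ⇔a = mk⇔ (λ ¬φ → contradiction (from φ⇔a a) ¬φ) λ ()
  literal-eq false (no ¬a) φ⇔a = mk⇔ (λ _ → refl) (λ _ → ¬a ∘ to φ⇔a)

  exactly-sat : ∀ {S} {ρ : Assignment m S (V (𝒢 t))} {y φ} {P : V (𝒢 t) → Set}
                (P? : ∀ a → Dec (P a)) → (∀ a → Sat (𝒢 t) (ρ [ y ↦ a ]) φ ⇔ P a) → ∀ c →
                Sat (𝒢 t) ρ (exactly c y φ) ⇔ (length (filter P? (allFin _)) ≡ c)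
  exactly-sat {t} {ρ = ρ} {y} {φ} P? φ⇔P c = mk⇔
    (λ sat → ℕ.≤-antisym (ℕ.≤-pred (ℕ.≰⇒> (sat false ∘ from (atLeast (suc c)))))
                         (to (atLeast c) (sat true)))
    (λ { refl true → from (atLeast _) ℕ.≤-refl
       ; refl false → ℕ.<⇒≱ ℕ.≤-refl ∘ to (atLeast _) })
    where
    atLeast : ∀ i → Sat (𝒢 t) ρ (∃≥ i y φ) ⇔ (i ≤ length (filter P? (allFin _)))
    atLeast i = mk⇔
      (λ (w , sat) → to (witnesses⇔≤count P? i) (w , λ j → to (φ⇔P _) (sat j)))
      (λ i≤ → let w , p = from (witnesses⇔≤count P? i) i≤ in w , λ j → from (φ⇔P _) (p j))

  -- Induction on the rounds. The formula is built from a tuple `z` of one graph but evaluated in an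
  -- arbitrary one, which is how a difference of colours becomes a separating sentence.
  char-sat : ∀ (r : ℕ) (z : Tuple s d) {S} (ν : Vec (Fin m) d) (ν∈ : Within ν S)
             {ρ : Assignment m S (V (𝒢 t))} {x : Tuple t d} → Names ρ ν x →
             Sat (𝒢 t) ρ (char r z ν ν∈) ⇔ rel r x z
  char-sat {t = t} zero z ν ν∈ {ρ} {x} names = mk⇔
    (λ sat i j → to (eqs i j) (sat (i , j) true) , to (adjs i j) (sat (i , j) false))
    (λ { rxz (i , j) true → from (eqs i j) (proj₁ (rxz i j))
       ; rxz (i , j) false → from (adjs i j) (proj₂ (rxz i j)) })
    where
    eqs : ∀ i j → _ ⇔ (eqᵇ x i j ≡ eqᵇ z i j)
    eqs i j = literal-eq (eqᵇ z i j) (lookup x i Fin.≟ lookup x j)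
      (mk⇔ (λ h → trans (sym (names i (ν∈ i))) (trans h (names j (ν∈ j))))
           (λ h → trans (names i (ν∈ i)) (trans h (sym (names j (ν∈ j))))))
    adjs : ∀ i j → _ ⇔ (adjᵇ x i j ≡ adjᵇ z i j)
    adjs i j = literal-eq (adjᵇ z i j) (Bool.T? (adjᵇ x i j))
      (mk⇔ (subst₂ (Edge (𝒢 t)) (names i (ν∈ i)) (names j (ν∈ j)))
           (subst₂ (Edge (𝒢 t)) (sym (names i (ν∈ i))) (sym (names j (ν∈ j)))))
  char-sat {d = d} (suc r) z ν ν∈ {ρ} {x} names = mk⇔
    (λ sat → to (char-sat r z ν ν∈ names) (sat true) , λ e π →
       to (selected e π) (sat false (e , π) true) ,
       λ u z′ → to (counted e π u z′) (sat false (e , π) false (u , z′)))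
    (λ { (rxz , refined) true → from (char-sat r z ν ν∈ names) rxz
       ; (rxz , refined) false (e , π) true → from (selected e π) (proj₁ (refined e π))
       ; (rxz , refined) false (e , π) false (u , z′) →
           from (counted e π u z′) (proj₂ (refined e π) u z′) })
    where
    selected : ∀ e (π : Vec (Fin d) (toℕ e)) → _ ⇔ rel r (sel x π) (sel z π)
    selected e π = char-sat r (sel z π) (sel ν π) (within-sel ν ν∈ π) (names-sel ρ ν x names π)
    counted : ∀ e (π : Vec (Fin d) (toℕ e)) u z′ →
              _ ⇔ (count r (sel x π) z′ ≡ count r (sel z π) z′)
    counted e π u z′ =
      let y , y∉ = freshFor e (sel ν π) in
      exactly-sat (λ a → rel? r (a ∷ sel x π) z′)
        (λ a → char-sat r z′ (y ∷ sel ν π) _ (names-∷ ρ (sel ν π) (sel x π) (names-sel ρ ν x names π) y∉ a)) _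

-- The stable colouring.

stabilise : ∀ {A : Set} {P : ℕ → A → Set} (P? : ∀ r a → Dec (P r a)) →
            (∀ {r a} → P (suc r) a → P r a) → (xs : List A) →
            ∃[ r ] (∀ {a} → a List.∈ xs → P r a → P (suc r) a)
-- The fuel exceeds the length of the list of survivors: a round that is not yet stable removes at
-- least one of them.
stabilise {A} {P} P? mono xs = go (suc (length xs)) 0 xs ℕ.≤-refl (λ a∈ _ → a∈)
  where
  go : ∀ n r ys → length ys < n → (∀ {a} → a List.∈ xs → P r a → a List.∈ ys) →
       ∃[ r ] (∀ {a} → a List.∈ xs → P r a → P (suc r) a)
  go (suc n) r ys (s≤s ≤n) inc with All.all? (P? (suc r)) ys
  ... | yes all = r , λ a∈ p → All.lookup all (inc a∈ p)
  ... | no ¬all = go n (suc r) (filter (P? (suc r)) ys)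
    (ℕ.<-≤-trans (List.filter-notAll (P? (suc r)) ys (¬All⇒Any¬ (P? (suc r)) ys ¬all)) ≤n)
    (λ a∈ p → ∈-filter⁺ (P? (suc r)) (inc a∈ (mono p)) p)

does-≡-transfer : ∀ {P Q : Set} (p? : Dec P) (q? : Dec Q) → does p? ≡ does q? → P → Q
does-≡-transfer p? (yes q) h p = q
does-≡-transfer p? (no ¬q) h p with () ← trans (sym (dec-true p? p)) h

sel-choice : ∀ {A : Set} {d e} (x : Vec A d) {x′ : Vec A e} (c : Fin e → Fin d) →
             (∀ i → lookup x′ i ≡ lookup x (c i)) → sel x (Vec.tabulate c) ≡ x′
sel-choice x {x′} c h =
  trans (sym (Vec.tabulate-∘ (lookup x) c))
        (trans (Vec.tabulate-cong (sym ∘ h)) (Vec.tabulate∘lookup x′))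

-- Read (x , y) as the monomial ∏ X[ xᵢ ↦ yᵢ ]: this is divisibility of multilinear monomials,
-- regardless of order and repetitions.
record _⊑_ {A B : Set} {d e} (p′ : Vec A e × Vec B e) (p : Vec A d × Vec B d) : Set where
  constructor positions
  field
    position : Fin e → Fin d
    fst-≡    : ∀ i → lookup (proj₁ p′) i ≡ lookup (proj₁ p) (position i)
    snd-≡    : ∀ i → lookup (proj₂ p′) i ≡ lookup (proj₂ p) (position i)

open _⊑_

-- An equivalence of tuples of vertices (of the same or of different graphs)
-- which is stable under colour refinement for tuples of length at most M.
record StableEquivalence (𝒢 : Bool → Graph) (M : ℕ) : Set₁ where
  infix 4 _~_ _~?_
  field
    _~_   : ∀ {s t d} → Vec (V (𝒢 s)) d → Vec (V (𝒢 t)) d → Set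
    _~?_  : ∀ {s t d} (x : Vec (V (𝒢 s)) d) (y : Vec (V (𝒢 t)) d) → Dec (x ~ y)
    ~-refl  : ∀ {s d} {x : Vec (V (𝒢 s)) d} → x ~ x
    ~-sym   : ∀ {s t d} {x : Vec (V (𝒢 s)) d} {y : Vec (V (𝒢 t)) d} → x ~ y → y ~ x
    ~-trans : ∀ {s t u d} {x : Vec (V (𝒢 s)) d} {y : Vec (V (𝒢 t)) d} {z : Vec (V (𝒢 u)) d} →
              x ~ y → y ~ z → x ~ z
    ~-eq    : ∀ {s t d} {x : Vec (V (𝒢 s)) d} {y : Vec (V (𝒢 t)) d} → x ~ y →
              ∀ i j → lookup x i ≡ lookup x j → lookup y i ≡ lookup y j
    ~-edge  : ∀ {s t d} {x : Vec (V (𝒢 s)) d} {y : Vec (V (𝒢 t)) d} → x ~ y →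
              ∀ i j → Edge (𝒢 s) (lookup x i) (lookup x j) → Edge (𝒢 t) (lookup y i) (lookup y j)
    ~-⊑     : ∀ {s t d e} {x : Vec (V (𝒢 s)) d} {y : Vec (V (𝒢 t)) d}
              {x′ : Vec (V (𝒢 s)) e} {y′ : Vec (V (𝒢 t)) e} → d ≤ suc M → e ≤ M →
              (x′ , y′) ⊑ (x , y) → x ~ y → x′ ~ y′
    ~-count : ∀ {s t d} {x : Vec (V (𝒢 s)) d} {y : Vec (V (𝒢 t)) d} → d ≤ M → x ~ y →
              ∀ {u} (z : Vec (V (𝒢 u)) (suc d)) →
              length (filter (λ a → a ∷ x ~? z) (allFin _)) ≡
              length (filter (λ b → b ∷ y ~? z) (allFin _))

module Stabilisation (𝒢 : Bool → Graph) (M : ℕ) where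

  open Refinement 𝒢 M

  private variable
    s t u : Bool
    d e : ℕ

  rel-refl : ∀ (r : ℕ) {x : Tuple s d} → rel r x x
  rel-refl zero    i j = refl , refl
  rel-refl (suc r) = rel-refl r , λ e π → rel-refl r , λ u z → refl

  rel-sym : ∀ (r : ℕ) {x : Tuple s d} {y : Tuple t d} → rel r x y → rel r y x
  rel-sym zero    xy i j = sym (proj₁ (xy i j)) , sym (proj₂ (xy i j))
  rel-sym (suc r) (xy , refined) = rel-sym r xy , λ e π →
    rel-sym r (proj₁ (refined e π)) , λ u z → sym (proj₂ (refined e π) u z)

  rel-trans : ∀ (r : ℕ) {x : Tuple s d} {y : Tuple t d} {z : Tuple u d} →
              rel r x y → rel r y z → rel r x z
  rel-trans zero    xy yz i j =
    trans (proj₁ (xy i j)) (proj₁ (yz i j)) , trans (proj₂ (xy i j)) (proj₂ (yz i j))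
  rel-trans (suc r) (xy , xy′) (yz , yz′) = rel-trans r xy yz , λ e π →
    rel-trans r (proj₁ (xy′ e π)) (proj₁ (yz′ e π)) , λ u z →
      trans (proj₂ (xy′ e π) u z) (proj₂ (yz′ e π) u z)

  rel⇒atomic : ∀ (r : ℕ) {x : Tuple s d} {y : Tuple t d} → rel r x y → rel 0 x y
  rel⇒atomic zero    xy = xy
  rel⇒atomic (suc r) xy = rel⇒atomic r (proj₁ xy)

  TuplePair : Set
  TuplePair = Σ ℕ λ d → Σ Bool λ s → Σ Bool λ t → Tuple s d × Tuple t d

  Related : ℕ → TuplePair → Set
  Related r (d , s , t , x , y) = rel r x y

  related? : ∀ r a → Dec (Related r a)
  related? r (d , s , t , x , y) = rel? r x y

  pairsOf : ∀ d s t → List TuplePair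
  pairsOf d s t =
    cartesianProductWith (λ x y → d , s , t , x , y) (vecs (allFin _) d) (vecs (allFin _) d)

  pairsFrom : ∀ d s → List TuplePair
  pairsFrom d s = concatMap (pairsOf d s) bools

  pairsOfLength : ∀ d → List TuplePair
  pairsOfLength d = concatMap (pairsFrom d) bools

  -- Length m = M + 1 is included because a tuple of length M extended by one vertex must still
  -- determine the colours of its subtuples.
  pairs : List TuplePair
  pairs = concatMap pairsOfLength (upTo (suc m))

  ∈-pairs : d ≤ m → (x : Tuple s d) (y : Tuple t d) → (d , s , t , x , y) List.∈ pairs
  ∈-pairs {d} {s} {t} d≤m x y =
    ∈-concatMap⁺ pairsOfLength {xs = upTo (suc m)} (List.lose (∈-upTo⁺ (s≤s d≤m))
      (∈-concatMap⁺ (pairsFrom d) {xs = bools} (List.lose (∈-bools s)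
        (∈-concatMap⁺ (pairsOf d s) {xs = bools} (List.lose (∈-bools t)
          (∈-cartesianProductWith⁺ (λ x y → d , s , t , x , y)
            (∈-vecs ∈-allFin x) (∈-vecs ∈-allFin y)))))))

  abstract
    R : ℕ
    R = proj₁ (stabilise related? proj₁ pairs)

    stable : d ≤ m → {x : Tuple s d} {y : Tuple t d} → rel R x y → rel (suc R) x y
    stable d≤m = proj₂ (stabilise related? proj₁ pairs) (∈-pairs d≤m _ _)

  Refined : ∀ {s t d} → Tuple s d → Tuple t d → ℕ → Set
  Refined {d = d} x y e = ∀ (π : Vec (Fin d) e) →
    rel R (sel x π) (sel y π) ×
    (∀ u (z : Tuple u (suc e)) → count R (sel x π) z ≡ count R (sel y π) z)

  refined : d ≤ m → e ≤ M → {x : Tuple s d} {y : Tuple t d} → rel R x y → Refined x y e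
  refined d≤m e≤M {x} {y} xy =
    subst (Refined x y) (Fin.toℕ-fromℕ< (s≤s e≤M)) (proj₂ (stable d≤m xy) (fromℕ< (s≤s e≤M)))

  stableEquivalence : StableEquivalence 𝒢 M
  stableEquivalence = record
    { _~_ = rel R
    ; _~?_ = rel? R
    ; ~-refl = rel-refl R
    ; ~-sym = rel-sym R
    ; ~-trans = rel-trans R
    ; ~-eq = λ {_} {_} {_} {x} {y} xy i j → does-≡-transfer (lookup x i Fin.≟ lookup x j)
               (lookup y i Fin.≟ lookup y j) (proj₁ (rel⇒atomic R xy i j))
    ; ~-edge = λ xy i j → subst T (proj₂ (rel⇒atomic R xy i j))
    ; ~-⊑ = λ {_} {_} {_} {_} {x} {y} d≤ e≤ inc xy →
        subst₂ (rel R) (sel-choice x (position inc) (fst-≡ inc)) (sel-choice y (position inc) (snd-≡ inc))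
          (proj₁ (refined d≤ e≤ xy (Vec.tabulate (position inc))))
    ; ~-count = λ {_} {_} {d} {x} {y} d≤ xy {u} z →
        subst₂ (λ x y → count R x z ≡ count R y z)
          (sel-choice x id (λ _ → refl)) (sel-choice y id (λ _ → refl))
          -- Refinement speaks about selections of `x`; the identity selection returns `x` itself.
          (proj₂ (refined (ℕ.m≤n⇒m≤1+n d≤) d≤ xy (Vec.tabulate id)) u z)
    }

  open StableEquivalence stableEquivalence

  -- The hypothesis only refutes separating sentences. Since the relation is decidable, it suffices
  -- to refute that the empty tuples differ, and if they did, the characteristic sentence of one of
  -- them would separate the graphs.
  indistinguishable⇒[]~[] : ¬ (∃[ φ ] ((𝒢 s ⊨ φ) × ¬ (_⊨_ (𝒢 t) {m} φ))) →
                            _~_ {s} {t} [] []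
  indistinguishable⇒[]~[] {s} {t} indist with rel? {s = t} {t = s} R [] []
  ... | yes p = rel-sym R p
  ... | no ¬p = contradiction
    (char R [] [] (λ ()) , from (char-sat {s = s} R [] [] (λ ()) {x = []} (λ ())) (rel-refl R) ,
     ¬p ∘ to (char-sat {s = s} R [] [] (λ ()) {x = []} (λ ()))) indist

-- Subtuples of concatenated tuples, and sums over such tuples.

⊑-trans : ∀ {A B : Set} {d e n} {p : Vec A d × Vec B d} {q : Vec A e × Vec B e}
          {r : Vec A n × Vec B n} → p ⊑ q → q ⊑ r → p ⊑ r
⊑-trans (positions f h₁ h₂) (positions g k₁ k₂) = positions (g ∘ f)
  (λ i → trans (h₁ i) (k₁ (f i))) (λ i → trans (h₂ i) (k₂ (f i)))

module _ {A B : Set} {d e : ℕ} (x : Vec A d) (y : Vec B d) (x′ : Vec A e) (y′ : Vec B e) where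

  ⊑-++ˡ : (x , y) ⊑ (x ++ x′ , y ++ y′)
  ⊑-++ˡ = positions (_↑ˡ e) (λ i → sym (Vec.lookup-++ˡ x x′ i)) (λ i → sym (Vec.lookup-++ˡ y y′ i))

  ⊑-++ʳ : (x′ , y′) ⊑ (x ++ x′ , y ++ y′)
  ⊑-++ʳ = positions (d ↑ʳ_) (λ i → sym (Vec.lookup-++ʳ x x′ i)) (λ i → sym (Vec.lookup-++ʳ y y′ i))

++-⊑ : ∀ {A B : Set} {d e n} {p : Vec A n × Vec B n}
       (x : Vec A d) (y : Vec B d) {x′ : Vec A e} {y′ : Vec B e} →
       (x , y) ⊑ p → (x′ , y′) ⊑ p → (x ++ x′ , y ++ y′) ⊑ p
++-⊑ []      []      _ q = q
++-⊑ (a ∷ x) (b ∷ y) (positions f h₁ h₂) q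
  with positions g k₁ k₂ ← ++-⊑ x y (positions (f ∘ suc) (h₁ ∘ suc) (h₂ ∘ suc)) q =
  positions (λ { zero → f zero ; (suc i) → g i })
            (λ { zero → h₁ zero ; (suc i) → k₁ i })
            (λ { zero → h₂ zero ; (suc i) → k₂ i })

⊑-tail : ∀ {A B : Set} {d} {x : Vec A d} {y : Vec B d} {a b} → (x , y) ⊑ (a ∷ x , b ∷ y)
⊑-tail = positions suc (λ _ → refl) (λ _ → refl)

module _ {A B : Set} {d e n : ℕ} (x : Vec A d) (x′ : Vec B d)
         (y : Vec A e) (y′ : Vec B e) (z : Vec A n) (z′ : Vec B n) where

  private
    xyz : Vec A (d ℕ.+ (e ℕ.+ n)) × Vec B (d ℕ.+ (e ℕ.+ n))
    xyz = x ++ (y ++ z) , x′ ++ (y′ ++ z′)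

    x⊑ : (x , x′) ⊑ xyz
    x⊑ = ⊑-++ˡ x x′ (y ++ z) (y′ ++ z′)
    y⊑ : (y , y′) ⊑ xyz
    y⊑ = ⊑-trans (⊑-++ˡ y y′ z z′) (⊑-++ʳ x x′ (y ++ z) (y′ ++ z′))
    z⊑ : (z , z′) ⊑ xyz
    z⊑ = ⊑-trans (⊑-++ʳ y y′ z z′) (⊑-++ʳ x x′ (y ++ z) (y′ ++ z′))

  ⊑-xy : (x ++ y , x′ ++ y′) ⊑ xyz
  ⊑-xy = ++-⊑ x x′ x⊑ y⊑

  ⊑-xz : (x ++ z , x′ ++ z′) ⊑ xyz
  ⊑-xz = ++-⊑ x x′ x⊑ z⊑

  ⊑-yx : (y ++ x , y′ ++ x′) ⊑ xyz
  ⊑-yx = ++-⊑ y y′ y⊑ x⊑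

𝟙-* : ∀ {P Q : Set} (p? : Dec P) (q? : Dec Q) → 𝟙 p? * 𝟙 q? ≡ 𝟙 (p? ×-dec q?)
𝟙-* (yes p) q? = ℚ.*-identityˡ _
𝟙-* (no ¬p) q? = ℚ.*-zeroˡ (𝟙 q?)

∑-vecs-++ : ∀ {A : Set} (xs : List A) d e f →
            ∑ (vecs xs (d ℕ.+ e)) f ≡ ∑ (vecs xs d) (λ u → ∑ (vecs xs e) (λ v → f (u ++ v)))
∑-vecs-++ xs zero    e f = sym (ℚ.+-identityʳ _)
∑-vecs-++ xs (suc d) e f = begin
  ∑ (vecs xs (suc d ℕ.+ e)) f
    ≡⟨ ∑-vecs-suc xs (d ℕ.+ e) f ⟩
  ∑ xs (λ a → ∑ (vecs xs (d ℕ.+ e)) (λ u → f (a ∷ u)))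
    ≡⟨ ∑-cong xs (λ a → ∑-vecs-++ xs d e (f ∘ (a ∷_))) ⟩
  ∑ xs (λ a → ∑ (vecs xs d) (λ u → ∑ (vecs xs e) (λ v → f (a ∷ u ++ v))))
    ≡⟨ ∑-vecs-suc xs d _ ⟨
  ∑ (vecs xs (suc d)) (λ u → ∑ (vecs xs e) (λ v → f (u ++ v))) ∎

-- Applied with `c` a coefficient of a polynomial, so that degree bounds are only called for on its
-- support.
*-cong-≢0 : ∀ {c a b} → (c ≢ 0ℚ → a ≡ b) → c * a ≡ c * b
*-cong-≢0 {c} {a} {b} h with c ℚ.≟ 0ℚ
... | yes refl = trans (ℚ.*-zeroˡ a) (sym (ℚ.*-zeroˡ b))
... | no c≢0   = cong (c *_) (h c≢0)

-- Class sizes and the pseudo-expectation.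

module Moments {𝒢 : Bool → Graph} {M : ℕ} (E : StableEquivalence 𝒢 M)
               (linked : ∀ s t → StableEquivalence._~_ E {s} {t} [] []) where

  open StableEquivalence E

  private variable
    s t u : Bool
    d e n : ℕ

  Tuple : Bool → ℕ → Set
  Tuple s d = Vec (V (𝒢 s)) d

  vertices : ∀ s → List (V (𝒢 s))
  vertices s = allFin (order (𝒢 s))

  tuples : ∀ s d → List (Tuple s d)
  tuples s = vecs (vertices s)

  ∑𝟙-extensions : d ≤ M → {x : Tuple s d} {y : Tuple t d} → x ~ y → (z : Tuple u (suc d)) →
                  ∑ (vertices s) (λ a → 𝟙 (a ∷ x ~? z)) ≡ ∑ (vertices t) (λ b → 𝟙 (b ∷ y ~? z))
  ∑𝟙-extensions {s = s} {t = t} d≤M {x} {y} x~y z = begin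
    ∑ (vertices s) (λ a → 𝟙 (a ∷ x ~? z))
      ≡⟨ ∑𝟙≡length (vertices s) (λ a → a ∷ x ~? z) ⟩
    fromℕ (List.length (List.filter (λ a → a ∷ x ~? z) (vertices s)))
      ≡⟨ cong fromℕ (~-count d≤M x~y z) ⟩
    fromℕ (List.length (List.filter (λ b → b ∷ y ~? z) (vertices t)))
      ≡⟨ ∑𝟙≡length (vertices t) (λ b → b ∷ y ~? z) ⟨
    ∑ (vertices t) (λ b → 𝟙 (b ∷ y ~? z)) ∎

  -- Distributing each a uniformly over the b with b ∷ y ~ a ∷ x is a transport
  -- plan with unit marginals on both sides.
  ∑-extensions : d ≤ M → {x : Tuple s d} {y : Tuple t d} → x ~ y →
                 (f : V (𝒢 s) → ℚ) (g : V (𝒢 t) → ℚ) →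
                 (∀ a b → a ∷ x ~ b ∷ y → f a ≡ g b) → ∑ (vertices s) f ≡ ∑ (vertices t) g
  ∑-extensions {s = s} {t = t} d≤M {x} {y} x~y f g f≡g = begin
    ∑ (vertices s) f
      ≡⟨ ∑-cong (vertices s) (λ a → spread (W a) (f a) (W≢0 a)) ⟩
    ∑ (vertices s) (λ a → W a * (f a * inv (W a)))
      ≡⟨ ∑-cong (vertices s) (λ a → ∑-*ʳ (vertices t) (k a) _) ⟨
    ∑ (vertices s) (λ a → ∑ (vertices t) (λ b → k a b * (f a * inv (W a))))
      ≡⟨ ∑-cong (vertices s) (λ a → ∑-cong (vertices t) (λ b → 𝟙-*-cong (b ∷ y ~? a ∷ x) λ r →
           cong₂ (λ p q → p * inv q) (f≡g a b (~-sym r)) (W≡W′ r))) ⟩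
    ∑ (vertices s) (λ a → ∑ (vertices t) (λ b → k a b * (g b * inv (W′ b))))
      ≡⟨ ∑-swap (vertices s) (vertices t) _ ⟩
    ∑ (vertices t) (λ b → ∑ (vertices s) (λ a → k a b * (g b * inv (W′ b))))
      ≡⟨ ∑-cong (vertices t) (λ b → ∑-*ʳ (vertices s) (λ a → k a b) _) ⟩
    ∑ (vertices t) (λ b → ∑ (vertices s) (λ a → k a b) * (g b * inv (W′ b)))
      ≡⟨ ∑-cong (vertices t) (λ b → cong (_* (g b * inv (W′ b))) (∑k≡W′ b)) ⟩
    ∑ (vertices t) (λ b → W′ b * (g b * inv (W′ b)))
      ≡⟨ ∑-cong (vertices t) (λ b → spread (W′ b) (g b) (W′≢0 b)) ⟨
    ∑ (vertices t) g ∎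
    where
    k : V (𝒢 s) → V (𝒢 t) → ℚ
    k a b = 𝟙 (b ∷ y ~? a ∷ x)
    W : V (𝒢 s) → ℚ
    W a = ∑ (vertices t) (k a)
    W′ : V (𝒢 t) → ℚ
    W′ b = ∑ (vertices t) (λ b′ → 𝟙 (b′ ∷ y ~? b ∷ y))
    spread : ∀ w c → w ≢ 0ℚ → c ≡ w * (c * inv w)
    spread w c w≢0 = begin
      c                ≡⟨ ℚ.*-identityʳ c ⟨
      c * 1ℚ           ≡⟨ cong (c *_) (inv-inverse w≢0) ⟨
      c * (w * inv w)  ≡⟨ solve 3 (λ c w i → c :* (w :* i) := w :* (c :* i)) refl c w (inv w) ⟩
      w * (c * inv w)  ∎
      where open +-*-Solver
    -- `W a` counts extensions of `y`; moved to extensions of `x`, the count includes `a` itself.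
    W≢0 : ∀ a → W a ≢ 0ℚ
    W≢0 a = subst (_≢ 0ℚ) (∑𝟙-extensions d≤M x~y (a ∷ x))
      (∑𝟙≢0 (λ a′ → a′ ∷ x ~? a ∷ x) (∈-allFin a) ~-refl)
    W′≢0 : ∀ b → W′ b ≢ 0ℚ
    W′≢0 b = ∑𝟙≢0 (λ b′ → b′ ∷ y ~? b ∷ y) (∈-allFin b) ~-refl
    W≡W′ : ∀ {a b} → b ∷ y ~ a ∷ x → W a ≡ W′ b
    W≡W′ {a} {b} r = ∑-cong (vertices t) λ b′ →
      𝟙-cong (b′ ∷ y ~? a ∷ x) (b′ ∷ y ~? b ∷ y) (λ r′ → ~-trans r′ (~-sym r)) (λ r′ → ~-trans r′ r)
    ∑k≡W′ : ∀ b → ∑ (vertices s) (λ a → k a b) ≡ W′ b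
    ∑k≡W′ b = trans
      (∑-cong (vertices s) λ a → 𝟙-cong (b ∷ y ~? a ∷ x) (a ∷ x ~? b ∷ y) ~-sym ~-sym)
      (∑𝟙-extensions d≤M x~y (b ∷ y))

  -- New entries are added at the front, so the sum over the first entry has to be the innermost
  -- one: it extends `u ++ x`, which has length at most M.
  ∑-tuple-extensions : ∀ n → n ℕ.+ d ≤ suc M → {x : Tuple s d} {y : Tuple t d} → x ~ y →
                       (f : Tuple s n → ℚ) (g : Tuple t n → ℚ) →
                       (∀ a b → a ++ x ~ b ++ y → f a ≡ g b) → ∑ (tuples s n) f ≡ ∑ (tuples t n) g
  ∑-tuple-extensions zero n≤ x~y f g f≡g = cong (_+ 0ℚ) (f≡g [] [] x~y)
  ∑-tuple-extensions {s = s} {t = t} (suc n) (s≤s n≤) {x} {y} x~y f g f≡g = begin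
    ∑ (tuples s (suc n)) f
      ≡⟨ trans (∑-vecs-suc (vertices s) n f) (∑-swap (vertices s) (tuples s n) _) ⟩
    ∑ (tuples s n) (λ u → ∑ (vertices s) (λ a → f (a ∷ u)))
      ≡⟨ ∑-tuple-extensions n (ℕ.m≤n⇒m≤1+n n≤) x~y _ _ (λ u v r →
           ∑-extensions n≤ r _ _ λ a b r′ → f≡g (a ∷ u) (b ∷ v) r′) ⟩
    ∑ (tuples t n) (λ v → ∑ (vertices t) (λ b → g (b ∷ v)))
      ≡⟨ trans (∑-vecs-suc (vertices t) n g) (∑-swap (vertices t) (tuples t n) _) ⟨
    ∑ (tuples t (suc n)) g ∎

  -- The count is taken in the first graph even if `y` lies in the second, so that class sizes on
  -- both sides can be compared without transport.
  classSize : Tuple t d → ℚ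
  classSize {d = d} y = ∑ (tuples true d) (λ u → 𝟙 (u ~? y))

  classSize-cong : {x : Tuple s d} {y : Tuple t d} → x ~ y → classSize x ≡ classSize y
  classSize-cong {d = d} {x = x} {y} x~y = ∑-cong (tuples true d) λ u →
    𝟙-cong (u ~? x) (u ~? y) (λ r → ~-trans r x~y) (λ r → ~-trans r (~-sym x~y))

  -- By `linked`, the empty tuples are equivalent, so stability gives the colour of `y` equally many
  -- tuples in both graphs; in its own graph `y` is one of them.
  classSize≢0 : d ≤ M → (y : Tuple t d) → classSize y ≢ 0ℚ
  classSize≢0 {d} {t} d≤M y = subst (_≢ 0ℚ) (sym size≡)
    (∑𝟙≢0 (λ u → u ~? y) (∈-vecs ∈-allFin y) ~-refl)
    where
    d+0≤ : d ℕ.+ 0 ≤ suc M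
    d+0≤ = ℕ.m≤n⇒m≤1+n (subst (_≤ M) (sym (ℕ.+-identityʳ d)) d≤M)
    size≡ : classSize y ≡ ∑ (tuples t d) (λ u → 𝟙 (u ~? y))
    size≡ = ∑-tuple-extensions d d+0≤ (linked true t) _ _ λ a b r →
      let a~b = ~-⊑ d+0≤ d≤M (⊑-++ˡ a b [] []) r in
      𝟙-cong (a ~? y) (b ~? y) (~-trans (~-sym a~b)) (~-trans a~b)

  -- The pseudo-expectation of the monomial ∏ X[ xᵢ ↦ yᵢ ].
  ℓ : Tuple true d → Tuple false d → ℚ
  ℓ x y = 𝟙 (x ~? y) * inv (classSize y)

  ℓ-unit : ℓ [] [] ≡ 1ℚ
  ℓ-unit = begin
    𝟙 ([] ~? []) * inv (𝟙 ([] ~? []) + 0ℚ)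
      ≡⟨ cong₂ (λ p q → p * inv (q + 0ℚ)) (𝟙-true ([] ~? []) (linked true false))
               (𝟙-true ([] ~? []) (linked true false)) ⟩
    1ℚ * inv (1ℚ + 0ℚ)
      ≡⟨⟩
    1ℚ ∎

  -- Selecting along `g` and along `f` are inverse bijections between the two classes. A member `u`
  -- of the class of `y` has the same equalities between its entries as `y`, hence is recovered from
  -- its selection. The two class sizes are compared by summing over the graph of this bijection in
  -- both orders.
  classSize-⊑ : d ≤ M → e ≤ M → {y : Tuple t d} {y′ : Tuple t e} {A : Set}
                {x : Vec A d} {x′ : Vec A e} → (x , y) ⊑ (x′ , y′) → (x′ , y′) ⊑ (x , y) →
                classSize y ≡ classSize y′
  classSize-⊑ {d} {e} {t} d≤ e≤ {y} {y′} (positions f _ f≡) (positions g _ g≡) = begin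
    ∑ (tuples true d) (λ u → 𝟙 (u ~? y))
      ≡⟨ ∑-cong (tuples true d) (λ u → single (u ~? y) (sel u (Vec.tabulate g))) ⟩
    ∑ (tuples true d) (λ u → ∑ (tuples true e) (λ u′ →
      𝟙 ((u ~? y) ×-dec (u′ ≟ sel u (Vec.tabulate g)))))
      ≡⟨ ∑-swap (tuples true d) (tuples true e) _ ⟩
    ∑ (tuples true e) (λ u′ → ∑ (tuples true d) (λ u →
      𝟙 ((u ~? y) ×-dec (u′ ≟ sel u (Vec.tabulate g)))))
      ≡⟨ ∑-cong (tuples true e) (λ u′ → ∑-cong (tuples true d) (λ u →
           𝟙-cong ((u ~? y) ×-dec (u′ ≟ sel u (Vec.tabulate g)))
                  ((u′ ~? y′) ×-dec (u ≟ sel u′ (Vec.tabulate f)))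
                  (λ { (r , refl) → transfer d≤ e≤ f g f≡ g≡ r })
                  (λ { (r , refl) → transfer e≤ d≤ g f g≡ f≡ r }))) ⟩
    ∑ (tuples true e) (λ u′ → ∑ (tuples true d) (λ u →
      𝟙 ((u′ ~? y′) ×-dec (u ≟ sel u′ (Vec.tabulate f)))))
      ≡⟨ ∑-cong (tuples true e) (λ u′ → single (u′ ~? y′) (sel u′ (Vec.tabulate f))) ⟨
    ∑ (tuples true e) (λ u′ → 𝟙 (u′ ~? y′)) ∎
    where
    _≟_ : ∀ {n} (u u′ : Tuple true n) → Dec (u ≡ u′)
    _≟_ = Vec.≡-dec Fin._≟_
    single : ∀ {n} {P : Set} (p? : Dec P) (c : Tuple true n) →
             𝟙 p? ≡ ∑ (tuples true n) (λ u → 𝟙 (p? ×-dec (u ≟ c)))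
    single {n} p? c = begin
      𝟙 p?                                                ≡⟨ ℚ.*-identityʳ _ ⟨
      𝟙 p? * 1ℚ                                           ≡⟨ cong (𝟙 p? *_) (𝟙-true (c ≟ c) refl) ⟨
      𝟙 p? * 𝟙 (c ≟ c)                                    ≡⟨ vecs-deltas (allFin-deltas _) n
                                                               (λ u → 𝟙 p? * 𝟙 (u ≟ c)) c (λ b b≢c →
                                                                 trans (cong (𝟙 p? *_) (𝟙-false (b ≟ c) b≢c))
                                                                       (ℚ.*-zeroʳ (𝟙 p?))) ⟨
      ∑ (tuples true n) (λ u → 𝟙 p? * 𝟙 (u ≟ c))          ≡⟨ ∑-cong (tuples true n) (λ u → 𝟙-* p? (u ≟ c)) ⟩
      ∑ (tuples true n) (λ u → 𝟙 (p? ×-dec (u ≟ c)))      ∎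
    transfer : ∀ {d e} → d ≤ M → e ≤ M → {y : Tuple t d} {y′ : Tuple t e} →
               (f : Fin d → Fin e) (g : Fin e → Fin d) →
               (∀ i → lookup y i ≡ lookup y′ (f i)) → (∀ i → lookup y′ i ≡ lookup y (g i)) →
               {u : Tuple true d} → u ~ y →
               sel u (Vec.tabulate g) ~ y′ × u ≡ sel (sel u (Vec.tabulate g)) (Vec.tabulate f)
    transfer d≤ e≤ {y} {y′} f g f≡ g≡ {u} r =
      ~-⊑ (ℕ.m≤n⇒m≤1+n d≤) e≤ (positions g lookup-g g≡) r ,
      sym (sel-choice (sel u (Vec.tabulate g)) f λ i → trans
        (~-eq (~-sym r) i (g (f i)) (trans (f≡ i) (g≡ (f i)))) (sym (lookup-g (f i))))
      where
      lookup-g : ∀ i → lookup (sel u (Vec.tabulate g)) i ≡ lookup u (g i)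
      lookup-g i = trans (lookup-sel u (Vec.tabulate g) i) (cong (lookup u) (Vec.lookup∘tabulate g i))

  -- Makes ℓ well defined on multilinear monomials: it only depends on the set of pairs (xᵢ , yᵢ),
  -- as X² = X demands.
  ℓ-⊑ : d ≤ M → e ≤ M → {x : Tuple true d} {y : Tuple false d}
        {x′ : Tuple true e} {y′ : Tuple false e} →
        (x , y) ⊑ (x′ , y′) → (x′ , y′) ⊑ (x , y) → ℓ x y ≡ ℓ x′ y′
  ℓ-⊑ d≤ e≤ {x} {y} {x′} {y′} p q = cong₂ (λ a b → a * inv b)
    (𝟙-cong (x ~? y) (x′ ~? y′) (~-⊑ (ℕ.m≤n⇒m≤1+n d≤) e≤ q) (~-⊑ (ℕ.m≤n⇒m≤1+n e≤) d≤ p))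
    (classSize-⊑ d≤ e≤ p q)

  -- Double counting: deleting the first entry maps the class of `a ∷ x` to that of `x`, and by
  -- stability every fibre is as large as the one over `y`.
  classSize-∷ : d ≤ M → {x : Tuple s d} {y : Tuple t d} → x ~ y → ∀ a →
                classSize (a ∷ x) ≡ classSize y * ∑ (vertices t) (λ b → 𝟙 (b ∷ y ~? a ∷ x))
  classSize-∷ {d} {s} {t} d≤M {x} {y} x~y a = begin
    ∑ (tuples true (suc d)) (λ u → 𝟙 (u ~? a ∷ x))
      ≡⟨ trans (∑-vecs-suc (vertices true) d _) (∑-swap (vertices true) (tuples true d) _) ⟩
    ∑ (tuples true d) (λ u → ∑ (vertices true) (λ c → 𝟙 (c ∷ u ~? a ∷ x)))
      ≡⟨ ∑-cong (tuples true d) inner ⟩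
    ∑ (tuples true d) (λ u → 𝟙 (u ~? y) * ∑ (vertices t) (λ b → 𝟙 (b ∷ y ~? a ∷ x)))
      ≡⟨ ∑-*ʳ (tuples true d) _ _ ⟩
    classSize y * ∑ (vertices t) (λ b → 𝟙 (b ∷ y ~? a ∷ x)) ∎
    where
    inner : ∀ u → ∑ (vertices true) (λ c → 𝟙 (c ∷ u ~? a ∷ x)) ≡
                  𝟙 (u ~? y) * ∑ (vertices t) (λ b → 𝟙 (b ∷ y ~? a ∷ x))
    inner u with u ~? y
    ... | yes u~y = trans (∑𝟙-extensions d≤M u~y (a ∷ x)) (sym (ℚ.*-identityˡ _))
    ... | no  u≁y = trans (∑-zero (vertices true) λ c → 𝟙-false (c ∷ u ~? a ∷ x) λ r →
                             u≁y (~-trans (~-⊑ (s≤s d≤M) d≤M ⊑-tail r) x~y))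
                          (sym (ℚ.*-zeroˡ (∑ (vertices t) (λ b → 𝟙 (b ∷ y ~? a ∷ x)))))

  cancel-inv : ∀ {a b c} → a ≢ 0ℚ → b ≢ 0ℚ → a ≡ b * c → c * inv a ≡ inv b
  cancel-inv {a} {b} {c} a≢0 b≢0 a≡bc = *-cancelˡ-≢0 b≢0 (begin
    b * (c * inv a)  ≡⟨ ℚ.*-assoc b c (inv a) ⟨
    (b * c) * inv a  ≡⟨ cong (_* inv a) a≡bc ⟨
    a * inv a        ≡⟨ inv-inverse a≢0 ⟩
    1ℚ               ≡⟨ inv-inverse b≢0 ⟨
    b * inv b        ∎)

  -- If `x ~ y`, every non-zero term is the inverse class size of `v ∷ x`, and `classSize-∷` counts
  -- these terms. If not, no extension is equivalent either and both sides are 0.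
  ℓ-row : suc d ≤ M → (x : Tuple true d) (y : Tuple false d) → ∀ v →
          ∑ (vertices false) (λ w → ℓ (v ∷ x) (w ∷ y)) ≡ ℓ x y
  ℓ-row {d} d<M x y v with d≤M ← ℕ.<⇒≤ d<M | x ~? y
  ... | no x≁y = trans
    (∑-zero (vertices false) λ w → trans
      (cong (_* _) (𝟙-false (v ∷ x ~? w ∷ y) λ r → x≁y (~-⊑ (s≤s d≤M) d≤M ⊑-tail r)))
      (ℚ.*-zeroˡ (inv (classSize (w ∷ y)))))
    (sym (ℚ.*-zeroˡ (inv (classSize y))))
  ... | yes x~y = begin
    ∑ (vertices false) (λ w → 𝟙 (v ∷ x ~? w ∷ y) * inv (classSize (w ∷ y)))
      ≡⟨ ∑-cong (vertices false) (λ w → trans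
           (𝟙-*-cong (v ∷ x ~? w ∷ y) (λ r → cong inv (classSize-cong (~-sym r))))
           (cong (_* inv (classSize (v ∷ x))) (𝟙-cong (v ∷ x ~? w ∷ y) (w ∷ y ~? v ∷ x) ~-sym ~-sym))) ⟩
    ∑ (vertices false) (λ w → 𝟙 (w ∷ y ~? v ∷ x) * inv (classSize (v ∷ x)))
      ≡⟨ ∑-*ʳ (vertices false) _ _ ⟩
    ∑ (vertices false) (λ w → 𝟙 (w ∷ y ~? v ∷ x)) * inv (classSize (v ∷ x))
      ≡⟨ cancel-inv (classSize≢0 d<M (v ∷ x)) (classSize≢0 d≤M y) (classSize-∷ d≤M x~y v) ⟩
    inv (classSize y)
      ≡⟨ ℚ.*-identityˡ _ ⟨
    1ℚ * inv (classSize y) ∎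

  ℓ-column : suc d ≤ M → (x : Tuple true d) (y : Tuple false d) → ∀ w →
             ∑ (vertices true) (λ v → ℓ (v ∷ x) (w ∷ y)) ≡ ℓ x y
  ℓ-column {d} d<M x y w with d≤M ← ℕ.<⇒≤ d<M | x ~? y
  ... | no x≁y = trans
    (∑-zero (vertices true) λ v → trans
      (cong (_* _) (𝟙-false (v ∷ x ~? w ∷ y) λ r → x≁y (~-⊑ (s≤s d≤M) d≤M ⊑-tail r)))
      (ℚ.*-zeroˡ (inv (classSize (w ∷ y)))))
    (sym (ℚ.*-zeroˡ (inv (classSize y))))
  ... | yes x~y = begin
    ∑ (vertices true) (λ v → 𝟙 (v ∷ x ~? w ∷ y) * inv (classSize (w ∷ y)))
      ≡⟨ ∑-*ʳ (vertices true) _ _ ⟩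
    ∑ (vertices true) (λ v → 𝟙 (v ∷ x ~? w ∷ y)) * inv (classSize (w ∷ y))
      ≡⟨ cancel-inv (classSize≢0 d<M (w ∷ y)) (classSize≢0 d≤M x) (classSize-∷ d≤M (~-sym x~y) w) ⟩
    inv (classSize x)
      ≡⟨ cong inv (classSize-cong x~y) ⟩
    inv (classSize y)
      ≡⟨ ℚ.*-identityˡ _ ⟨
    1ℚ * inv (classSize y) ∎

-- The Casimir identity and the gain of one degree.

module Convolution {𝒢 : Bool → Graph} {M : ℕ} (E : StableEquivalence 𝒢 M)
               (linked : ∀ s t → StableEquivalence._~_ E {s} {t} [] []) where

  open StableEquivalence E
  open Moments E linked

  private variable
    s t u : Bool
    d e n : ℕ

  class-∑ : ∀ (z : Tuple t (d ℕ.+ e)) (f : Tuple true d → Tuple true e → ℚ) c →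
            (∀ q r → q ++ r ~ z → f q r ≡ c) →
            ∑ (tuples true d) (λ q → ∑ (tuples true e) (λ r → 𝟙 (q ++ r ~? z) * f q r)) ≡
            classSize z * c
  class-∑ {d = d} {e} z f c f≡c = begin
    ∑ (tuples true d) (λ q → ∑ (tuples true e) (λ r → 𝟙 (q ++ r ~? z) * f q r))
      ≡⟨ ∑-cong (tuples true d) (λ q → trans
           (∑-cong (tuples true e) λ r → 𝟙-*-cong (q ++ r ~? z) (f≡c q r))
           (∑-*ʳ (tuples true e) _ c)) ⟩
    ∑ (tuples true d) (λ q → ∑ (tuples true e) (λ r → 𝟙 (q ++ r ~? z)) * c)
      ≡⟨ ∑-*ʳ (tuples true d) _ c ⟩
    ∑ (tuples true d) (λ q → ∑ (tuples true e) (λ r → 𝟙 (q ++ r ~? z))) * c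
      ≡⟨ cong (_* c) (∑-vecs-++ (vertices true) d e _) ⟨
    classSize z * c ∎

  -- Both sides count the triples (p , q , r) in the first graph with
  -- p ++ q ~ w′ ++ w, p ++ r ~ w′ ++ b and q ++ r ~ v ++ a.
  triangles : n ℕ.+ (d ℕ.+ e) ≤ M →
              (v : Tuple true d) (w : Tuple false d) (a : Tuple true e) (b : Tuple false e)
              (w′ : Tuple false n) →
              classSize (v ++ a) *
                ∑ (tuples true n) (λ p → 𝟙 (p ++ v ~? w′ ++ w) * 𝟙 (p ++ a ~? w′ ++ b)) ≡
              classSize (w′ ++ b) *
                ∑ (tuples false d) (λ q → 𝟙 (q ++ b ~? v ++ a) * 𝟙 (w′ ++ q ~? w′ ++ w))
  triangles {n} {d} {e} bound v w a b w′ = begin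
    classSize (v ++ a) * ∑ (tuples true n) (λ p → pq p v * pr p a)
      ≡⟨ class-∑ (v ++ a) (λ q r → ∑ (tuples true n) (λ p → pq p q * pr p r)) _ first ⟨
    ∑ (tuples true d) (λ q → ∑ (tuples true e) (λ r →
      qr q r * ∑ (tuples true n) (λ p → pq p q * pr p r)))
      ≡⟨ ∑-cong (tuples true d) (λ q → ∑-cong (tuples true e) λ r →
           ∑-*ˡ (tuples true n) (qr q r) _) ⟨
    ∑ (tuples true d) (λ q → ∑ (tuples true e) (λ r → ∑ (tuples true n) (λ p →
      qr q r * (pq p q * pr p r))))
      ≡⟨ ∑-cong (tuples true d) (λ q → ∑-swap (tuples true e) (tuples true n) _) ⟩
    ∑ (tuples true d) (λ q → ∑ (tuples true n) (λ p → ∑ (tuples true e) (λ r →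
      qr q r * (pq p q * pr p r))))
      ≡⟨ ∑-swap (tuples true d) (tuples true n) _ ⟩
    ∑ (tuples true n) (λ p → ∑ (tuples true d) (λ q → ∑ (tuples true e) (λ r →
      qr q r * (pq p q * pr p r))))
      ≡⟨ ∑-cong (tuples true n) (λ p → ∑-swap (tuples true d) (tuples true e) _) ⟩
    ∑ (tuples true n) (λ p → ∑ (tuples true e) (λ r → ∑ (tuples true d) (λ q →
      qr q r * (pq p q * pr p r))))
      ≡⟨ ∑-cong (tuples true n) (λ p → ∑-cong (tuples true e) λ r →
           trans (∑-cong (tuples true d) λ q → rotate (qr q r) (pq p q) (pr p r))
                 (∑-*ˡ (tuples true d) (pr p r) _)) ⟩
    ∑ (tuples true n) (λ p → ∑ (tuples true e) (λ r →
      pr p r * ∑ (tuples true d) (λ q → qr q r * pq p q)))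
      ≡⟨ class-∑ (w′ ++ b) (λ p r → ∑ (tuples true d) (λ q → qr q r * pq p q)) _ second ⟩
    classSize (w′ ++ b) *
      ∑ (tuples false d) (λ q → 𝟙 (q ++ b ~? v ++ a) * 𝟙 (w′ ++ q ~? w′ ++ w)) ∎
    where
    pq : Tuple true n → Tuple true d → ℚ
    pq p q = 𝟙 (p ++ q ~? w′ ++ w)
    pr : Tuple true n → Tuple true e → ℚ
    pr p r = 𝟙 (p ++ r ~? w′ ++ b)
    qr : Tuple true d → Tuple true e → ℚ
    qr q r = 𝟙 (q ++ r ~? v ++ a)
    rotate : ∀ x y z → x * (y * z) ≡ z * (x * y)
    rotate = solve 3 (λ x y z → x :* (y :* z) := z :* (x :* y)) refl
      where open +-*-Solver
    bound′ : n ℕ.+ (d ℕ.+ e) ≤ suc M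
    bound′ = ℕ.m≤n⇒m≤1+n bound
    swapped : d ℕ.+ (n ℕ.+ e) ≤ suc M
    swapped = subst (_≤ suc M) (x+yz≡y+xz n d e) bound′
      where
      x+yz≡y+xz : ∀ x y z → x ℕ.+ (y ℕ.+ z) ≡ y ℕ.+ (x ℕ.+ z)
      x+yz≡y+xz x y z = trans (sym (ℕ.+-assoc x y z))
        (trans (cong (ℕ._+ z) (ℕ.+-comm x y)) (ℕ.+-assoc y x z))
    n+d≤M : n ℕ.+ d ≤ M
    n+d≤M = ℕ.≤-trans (ℕ.+-monoʳ-≤ n (ℕ.m≤m+n d e)) bound
    n+e≤M : n ℕ.+ e ≤ M
    n+e≤M = ℕ.≤-trans (ℕ.+-monoʳ-≤ n (ℕ.m≤n+m e d)) bound
    d+e≤M : d ℕ.+ e ≤ M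
    d+e≤M = ℕ.≤-trans (ℕ.m≤n+m (d ℕ.+ e) n) bound
    𝟙-~ : ∀ {s t u k} {x : Tuple s k} {y : Tuple t k} (z : Tuple u k) → x ~ y →
          𝟙 (x ~? z) ≡ 𝟙 (y ~? z)
    𝟙-~ {x = x} {y} z r = 𝟙-cong (x ~? z) (y ~? z) (~-trans (~-sym r)) (~-trans r)
    -- Once the side `q ++ r` is fixed, the number of `p` depends only on its colour. The tuples
    -- extended here have total length n + (d + e), which is what `bound` limits.
    first : ∀ q r → q ++ r ~ v ++ a →
            ∑ (tuples true n) (λ p → pq p q * pr p r) ≡ ∑ (tuples true n) (λ p → pq p v * pr p a)
    first q r qr~va = ∑-tuple-extensions n bound′ qr~va _ _ λ p p′ h → cong₂ _*_
      (𝟙-~ (w′ ++ w) (~-⊑ bound′ n+d≤M (⊑-xy p p′ q v r a) h))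
      (𝟙-~ (w′ ++ b) (~-⊑ bound′ n+e≤M (⊑-xz p p′ q v r a) h))
    -- The side `p ++ r` lies in the first graph and its representative `w′ ++ b` in the second, so
    -- the count of `q` changes graphs here.
    second : ∀ p r → p ++ r ~ w′ ++ b → ∑ (tuples true d) (λ q → qr q r * pq p q) ≡
             ∑ (tuples false d) (λ q → 𝟙 (q ++ b ~? v ++ a) * 𝟙 (w′ ++ q ~? w′ ++ w))
    second p r pr~w′b = ∑-tuple-extensions d swapped pr~w′b _ _ λ q q′ h → cong₂ _*_
      (𝟙-~ (v ++ a) (~-⊑ swapped d+e≤M (⊑-xz q q′ p w′ r b) h))
      (𝟙-~ (w′ ++ w) (~-⊑ swapped n+d≤M (⊑-yx q q′ p w′ r b) h))

  -- The kernel left over from the convolution. It compares tuples of the second graph only and does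
  -- not involve `a` and `b`, so it comes out of a sum over the second factor.
  Z : Tuple false n → Tuple false d → Tuple false d → ℚ
  Z w′ w q = 𝟙 (w′ ++ q ~? w′ ++ w) * inv (classSize (w′ ++ w))

  ℓ-convolution : n ℕ.+ (d ℕ.+ e) ≤ M →
                  (v : Tuple true d) (w : Tuple false d) (a : Tuple true e) (b : Tuple false e)
                  (w′ : Tuple false n) →
                  ∑ (tuples true n) (λ p → ℓ (p ++ v) (w′ ++ w) * ℓ (p ++ a) (w′ ++ b)) ≡
                  ∑ (tuples false d) (λ q → ℓ (v ++ a) (q ++ b) * Z w′ w q)
  ℓ-convolution {n} {d} {e} bound v w a b w′ = begin
    ∑ (tuples true n) (λ p → ℓ (p ++ v) (w′ ++ w) * ℓ (p ++ a) (w′ ++ b))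
      ≡⟨ trans (∑-cong (tuples true n) λ p →
           interchange-* (𝟙 (p ++ v ~? w′ ++ w)) (inv ω) (𝟙 (p ++ a ~? w′ ++ b)) (inv β)) (∑-*ʳ (tuples true n) _ _) ⟩
    σ * (inv ω * inv β)
      ≡⟨ balance ⟩
    σ′ * (inv α * inv ω)
      ≡⟨ trans (∑-cong (tuples false d) λ q →
           interchange-* (𝟙 (q ++ b ~? v ++ a)) (inv α) (𝟙 (w′ ++ q ~? w′ ++ w)) (inv ω)) (∑-*ʳ (tuples false d) _ _) ⟨
    ∑ (tuples false d) (λ q → 𝟙 (q ++ b ~? v ++ a) * inv α * Z w′ w q)
      ≡⟨ ∑-cong (tuples false d) (λ q → cong (_* Z w′ w q) (trans
           (𝟙-*-cong (q ++ b ~? v ++ a) (λ r → cong inv (classSize-cong (~-sym r))))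
           (cong (_* inv (classSize (q ++ b)))
                 (𝟙-cong (q ++ b ~? v ++ a) (v ++ a ~? q ++ b) ~-sym ~-sym)))) ⟩
    ∑ (tuples false d) (λ q → ℓ (v ++ a) (q ++ b) * Z w′ w q) ∎
    where
    ω β α σ σ′ : ℚ
    ω = classSize (w′ ++ w)
    β = classSize (w′ ++ b)
    α = classSize (v ++ a)
    σ = ∑ (tuples true n) (λ p → 𝟙 (p ++ v ~? w′ ++ w) * 𝟙 (p ++ a ~? w′ ++ b))
    σ′ = ∑ (tuples false d) (λ q → 𝟙 (q ++ b ~? v ++ a) * 𝟙 (w′ ++ q ~? w′ ++ w))
    open +-*-Solver
    interchange-* : ∀ x y z u → (x * y) * (z * u) ≡ (x * z) * (y * u)
    interchange-* = solve 4 (λ x y z u → (x :* y) :* (z :* u) := (x :* z) :* (y :* u)) refl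
    α≢0 : α ≢ 0ℚ
    α≢0 = classSize≢0 (ℕ.≤-trans (ℕ.m≤n+m (d ℕ.+ e) n) bound) (v ++ a)
    β≢0 : β ≢ 0ℚ
    β≢0 = classSize≢0 (ℕ.≤-trans (ℕ.+-monoʳ-≤ n (ℕ.m≤n+m e d)) bound) (w′ ++ b)
    -- `triangles` says ασ = βσ′. Dividing by α and β gives the claim, with `inv ω` as a common
    -- factor.
    balance : σ * (inv ω * inv β) ≡ σ′ * (inv α * inv ω)
    balance = *-cancelˡ-≢0 α≢0 (begin
      α * (σ * (inv ω * inv β))   ≡⟨ ℚ.*-assoc α σ (inv ω * inv β) ⟨
      (α * σ) * (inv ω * inv β)   ≡⟨ cong (_* (inv ω * inv β)) (triangles bound v w a b w′) ⟩
      (β * σ′) * (inv ω * inv β)  ≡⟨ solve 4 (λ x y z u → (x :* y) :* (z :* u) := (x :* u) :* (y :* z))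
                                       refl β σ′ (inv ω) (inv β) ⟩
      (β * inv β) * (σ′ * inv ω)  ≡⟨ cong (_* (σ′ * inv ω)) (trans (inv-inverse β≢0) (sym (inv-inverse α≢0))) ⟩
      (α * inv α) * (σ′ * inv ω)  ≡⟨ solve 4 (λ x y z u → (x :* u) :* (y :* z) := x :* (y :* (u :* z)))
                                       refl α σ′ (inv ω) (inv α) ⟩
      α * (σ′ * (inv α * inv ω))  ∎)

  module Functional {I : Set} (I* : List I) (size : I → ℕ)
                    (dom : ∀ S → Tuple true (size S)) (cod : ∀ S → Tuple false (size S)) where

    -- The pseudo-expectation of p times the monomial ∏ X[ xᵢ ↦ yᵢ ].
    F : (I → ℚ) → Tuple true n → Tuple false n → ℚ
    F p x y = ∑ I* (λ S → p S * ℓ (x ++ dom S) (y ++ cod S))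

    -- By the convolution identity ∑ F² = 0.
    vanishing-extends : ∀ {k} p → (∀ S → p S ≢ 0ℚ → size S ≤ k) →
                        (∀ {d} → d ≤ k → ∀ (x : Tuple true d) y → F p x y ≡ 0ℚ) →
                        n ℕ.+ (k ℕ.+ k) ≤ M → ∀ (x : Tuple true n) y → F p x y ≡ 0ℚ
    vanishing-extends {n} {k} p bounded vanishes bound x y =
      square≡0⇒≡0 _ (∑≡0⇒≡0 {f = λ y → F p x y * F p x y} (λ y → square-nonNeg (F p x y))
        (∑≡0⇒≡0 (λ x → ∑-nonNeg (tuples false n) (λ y → square-nonNeg (F p x y)))
          ∑F²≡0 (∈-vecs ∈-allFin x))
        (∈-vecs ∈-allFin y))
      where
      bounds : ∀ {S T} → p S ≢ 0ℚ → p T ≢ 0ℚ → n ℕ.+ (size S ℕ.+ size T) ≤ M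
      bounds {S} {T} pS pT = ℕ.≤-trans (ℕ.+-monoʳ-≤ n (ℕ.+-mono-≤ (bounded S pS) (bounded T pT))) bound
      left-comm : ∀ a b c → a * (b * c) ≡ b * (a * c)
      left-comm = solve 3 (λ a b c → a :* (b :* c) := b :* (a :* c)) refl
        where open +-*-Solver
      column≡0 : ∀ S → p S ≢ 0ℚ → ∀ y →
                 ∑ (tuples true n) (λ x → ℓ (x ++ dom S) (y ++ cod S) * F p x y) ≡ 0ℚ
      column≡0 S pS y = begin
        ∑ (tuples true n) (λ x → ℓ (x ++ dom S) (y ++ cod S) * F p x y)
          ≡⟨ ∑-cong (tuples true n) (λ x → trans (sym (∑-*ˡ I* (ℓ (x ++ dom S) (y ++ cod S)) _))
               (∑-cong I* λ T → left-comm (ℓ (x ++ dom S) (y ++ cod S)) (p T) _)) ⟩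
        ∑ (tuples true n) (λ x → ∑ I* (λ T →
          p T * (ℓ (x ++ dom S) (y ++ cod S) * ℓ (x ++ dom T) (y ++ cod T))))
          ≡⟨ trans (∑-swap (tuples true n) I* _) (∑-cong I* λ T → ∑-*ˡ (tuples true n) (p T) _) ⟩
        ∑ I* (λ T → p T *
          ∑ (tuples true n) (λ x → ℓ (x ++ dom S) (y ++ cod S) * ℓ (x ++ dom T) (y ++ cod T)))
          ≡⟨ ∑-cong I* (λ T → *-cong-≢0 λ pT →
               ℓ-convolution (bounds pS pT) (dom S) (cod S) (dom T) (cod T) y) ⟩
        ∑ I* (λ T → p T *
          ∑ (tuples false (size S)) (λ q → ℓ (dom S ++ dom T) (q ++ cod T) * Z y (cod S) q))
          ≡⟨ trans (∑-cong I* λ T → trans (sym (∑-*ˡ (tuples false (size S)) (p T) _))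
                     (∑-cong (tuples false (size S)) λ q → sym (ℚ.*-assoc (p T) _ _)))
                   (∑-swap I* (tuples false (size S)) _) ⟩
        ∑ (tuples false (size S)) (λ q → ∑ I* (λ T →
          p T * ℓ (dom S ++ dom T) (q ++ cod T) * Z y (cod S) q))
          ≡⟨ ∑-zero (tuples false (size S)) (λ q → trans (∑-*ʳ I* _ (Z y (cod S) q))
               -- The test monomial is now given by `dom S` and `q`. Its degree is that of a
               -- monomial of `p`, hence at most k whatever `n` is, and the hypothesis applies.
               (trans (cong (_* Z y (cod S) q) (vanishes (bounded S pS) (dom S) q))
                      (ℚ.*-zeroˡ (Z y (cod S) q)))) ⟩
        0ℚ ∎
      ∑F²≡0 : ∑ (tuples true n) (λ x → ∑ (tuples false n) (λ y → F p x y * F p x y)) ≡ 0ℚ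
      ∑F²≡0 = trans (∑-swap (tuples true n) (tuples false n) _)
        (∑-zero (tuples false n) λ y → begin
          ∑ (tuples true n) (λ x → F p x y * F p x y)
            ≡⟨ ∑-cong (tuples true n) (λ x → trans (sym (∑-*ʳ I* _ (F p x y)))
                 (∑-cong I* λ S → ℚ.*-assoc (p S) _ _)) ⟩
          ∑ (tuples true n) (λ x → ∑ I* (λ S → p S * (ℓ (x ++ dom S) (y ++ cod S) * F p x y)))
            ≡⟨ trans (∑-swap (tuples true n) I* _) (∑-cong I* λ S → ∑-*ˡ (tuples true n) (p S) _) ⟩
          ∑ I* (λ S → p S * ∑ (tuples true n) (λ x → ℓ (x ++ dom S) (y ++ cod S) * F p x y))
            ≡⟨ ∑-zero I* (λ S → trans (*-cong-≢0 λ pS → column≡0 S pS y) (ℚ.*-zeroʳ (p S))) ⟩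
          0ℚ ∎)

-- Multilinear monomials as subsets.

subsets : ∀ N → List (Subset N)
subsets = vecs bools

∑-subsets-suc : ∀ N (f : Subset (suc N) → ℚ) →
                ∑ (subsets (suc N)) f ≡
                ∑ (subsets N) (f ∘ (true ∷_)) + (∑ (subsets N) (f ∘ (false ∷_)) + 0ℚ)
∑-subsets-suc N = ∑-vecs-suc bools N

-- Multiplication by x pushes coefficients forward along S ↦ S ∪ ⁅ x ⁆; the adjoint operation is
-- composition with this map. The induction follows the position of x, the only coordinate in which
-- S and its image can differ.
∑-∙ : ∀ {N} (x : Fin N) (p : Poly N) (f : Subset N → ℚ) →
      ∑ (subsets N) (λ S → (x ∙ p) S * f S) ≡ ∑ (subsets N) (λ S → p S * f (S ∪ ⁅ x ⁆))
∑-∙ {suc N} zero p f = begin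
  ∑ (subsets (suc N)) (λ S → (zero ∙ p) S * f S)
    ≡⟨ ∑-subsets-suc N _ ⟩
  ∑ (subsets N) (λ S → (p (true ∷ S) + p (false ∷ (S Subset.─ Subset.⊥))) * f (true ∷ S)) +
    (∑ (subsets N) (λ S → 0ℚ * f (false ∷ S)) + 0ℚ)
    ≡⟨ cong₂ _+_
         (trans (∑-cong (subsets N) λ S → trans
            (cong (λ T → (p (true ∷ S) + p (false ∷ T)) * f (true ∷ S)) (p─⊥≡p S))
            (ℚ.*-distribʳ-+ (f (true ∷ S)) (p (true ∷ S)) (p (false ∷ S))))
           (∑-+ (subsets N) (λ S → p (true ∷ S) * f (true ∷ S)) (λ S → p (false ∷ S) * f (true ∷ S))))
         (trans (ℚ.+-identityʳ _) (∑-zero (subsets N) λ S → ℚ.*-zeroˡ (f (false ∷ S)))) ⟩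
  (∑ (subsets N) (λ S → p (true ∷ S) * f (true ∷ S)) +
    ∑ (subsets N) (λ S → p (false ∷ S) * f (true ∷ S))) + 0ℚ
    ≡⟨ ℚ.+-assoc (∑ (subsets N) (λ S → p (true ∷ S) * f (true ∷ S))) _ 0ℚ ⟩
  ∑ (subsets N) (λ S → p (true ∷ S) * f (true ∷ S)) +
    (∑ (subsets N) (λ S → p (false ∷ S) * f (true ∷ S)) + 0ℚ)
    ≡⟨ cong₂ (λ a b → a + (b + 0ℚ)) (∪⊥ true) (∪⊥ false) ⟨
  ∑ (subsets N) (λ S → p (true ∷ S) * f (true ∷ (S ∪ Subset.⊥))) +
    (∑ (subsets N) (λ S → p (false ∷ S) * f (true ∷ (S ∪ Subset.⊥))) + 0ℚ)
    ≡⟨ ∑-subsets-suc N _ ⟨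
  ∑ (subsets (suc N)) (λ S → p S * f (S ∪ ⁅ zero ⁆)) ∎
  where
  ∪⊥ : ∀ b → ∑ (subsets N) (λ S → p (b ∷ S) * f (true ∷ (S ∪ Subset.⊥))) ≡
             ∑ (subsets N) (λ S → p (b ∷ S) * f (true ∷ S))
  ∪⊥ b = ∑-cong (subsets N) λ S → cong (λ T → p (b ∷ S) * f (true ∷ T)) (∪-identityʳ S)
∑-∙ {suc N} (suc x) p f = begin
  ∑ (subsets (suc N)) (λ S → (suc x ∙ p) S * f S)
    ≡⟨ ∑-subsets-suc N _ ⟩
  ∑ (subsets N) (λ S → (x ∙ (p ∘ (true ∷_))) S * f (true ∷ S)) +
    (∑ (subsets N) (λ S → (x ∙ (p ∘ (false ∷_))) S * f (false ∷ S)) + 0ℚ)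
    ≡⟨ cong₂ (λ a b → a + (b + 0ℚ)) (∑-∙ x (p ∘ (true ∷_)) (f ∘ (true ∷_)))
                                    (∑-∙ x (p ∘ (false ∷_)) (f ∘ (false ∷_))) ⟩
  ∑ (subsets N) (λ S → p (true ∷ S) * f (true ∷ (S ∪ ⁅ x ⁆))) +
    (∑ (subsets N) (λ S → p (false ∷ S) * f (false ∷ (S ∪ ⁅ x ⁆))) + 0ℚ)
    ≡⟨ ∑-subsets-suc N _ ⟨
  ∑ (subsets (suc N)) (λ S → p S * f (S ∪ ⁅ suc x ⁆)) ∎

∣p∪⁅x⁆∣≤1+∣p∣ : ∀ {N} (p : Subset N) x → ∣ p ∪ ⁅ x ⁆ ∣ ≤ suc ∣ p ∣
∣p∪⁅x⁆∣≤1+∣p∣ {suc N} (true ∷ p)  zero rewrite ∪-identityʳ p = ℕ.n≤1+n _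
∣p∪⁅x⁆∣≤1+∣p∣ {suc N} (false ∷ p) zero rewrite ∪-identityʳ p = ℕ.≤-refl
∣p∪⁅x⁆∣≤1+∣p∣ (true ∷ p)  (suc x) = s≤s (∣p∪⁅x⁆∣≤1+∣p∣ p x)
∣p∪⁅x⁆∣≤1+∣p∣ (false ∷ p) (suc x) = ∣p∪⁅x⁆∣≤1+∣p∣ p x

elements : ∀ {N} (S : Subset N) → Vec (Fin N) ∣ S ∣
elements []          = []
elements (true ∷ S)  = zero ∷ Vec.map suc (elements S)
elements (false ∷ S) = Vec.map suc (elements S)

∈-elements⁺ : ∀ {N} {S : Subset N} {x} → x ∈ S → x Vec.∈ elements S
∈-elements⁺ {S = true ∷ S}  here      = VecAny.here refl
∈-elements⁺ {S = true ∷ S}  (there p) = VecAny.there (∈-map⁺ suc (∈-elements⁺ p))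
∈-elements⁺ {S = false ∷ S} (there p) = ∈-map⁺ suc (∈-elements⁺ p)

∈-elements⁻ : ∀ {N} {S : Subset N} {x} → x Vec.∈ elements S → x ∈ S
∈-elements⁻ {S = true ∷ S} (VecAny.here refl) = here
∈-elements⁻ {S = true ∷ S} (VecAny.there q)
  with y , y∈ , refl ← fromAny (VecAny.map⁻ q) = there (∈-elements⁻ y∈)
∈-elements⁻ {S = false ∷ S} q
  with y , y∈ , refl ← fromAny (VecAny.map⁻ q) = there (∈-elements⁻ y∈)

_⊆ᵛ_ : ∀ {A : Set} {d e} → Vec A d → Vec A e → Set
xs ⊆ᵛ ys = ∀ {x} → x Vec.∈ xs → x Vec.∈ ys

map-⊑ : ∀ {A B C : Set} (f : A → B) (g : A → C) {d e} {xs : Vec A d} {ys : Vec A e} →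
        xs ⊆ᵛ ys → (Vec.map f xs , Vec.map g xs) ⊑ (Vec.map f ys , Vec.map g ys)
map-⊑ f g {xs = xs} {ys} inc = positions (λ i → VecAny.index (pos i)) (image f) (image g)
  where
  pos : ∀ i → lookup xs i Vec.∈ ys
  pos i = inc (∈-lookup i xs)
  image : ∀ {D : Set} (h : _ → D) i → lookup (Vec.map h xs) i ≡ lookup (Vec.map h ys) (VecAny.index (pos i))
  image h i = trans (Vec.lookup-map i h xs)
    (trans (cong h (VecAny.lookup-index (pos i))) (sym (Vec.lookup-map (VecAny.index (pos i)) h ys)))

-- Soundness of the polynomial calculus for the pseudo-expectation.

module Soundness {𝒢 : Bool → Graph} {M : ℕ} (E : StableEquivalence 𝒢 M)
                 (linked : ∀ s t → StableEquivalence._~_ E {s} {t} [] []) where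

  open StableEquivalence E
  open Moments E linked
  open Convolution E linked

  G H : Graph
  G = 𝒢 true
  H = 𝒢 false

  N : ℕ
  N = numVars G H

  private variable
    n m k : ℕ

  dom : Vec (Fin N) n → Tuple true n
  dom = Vec.map (quotient (order H))

  cod : Vec (Fin N) n → Tuple false n
  cod = Vec.map (remainder {order G} (order H))

  X : V G → V H → Fin N
  X v w = X[_↦_] G H v w

  quotient-X : ∀ v w → quotient (order H) (X v w) ≡ v
  quotient-X v w = cong proj₁ (Fin.remQuot-combine v w)

  remainder-X : ∀ v w → remainder {order G} (order H) (X v w) ≡ w
  remainder-X v w = cong proj₂ (Fin.remQuot-combine v w)

  dom-zip : (x : Tuple true n) (y : Tuple false n) → dom (Vec.zipWith X x y) ≡ x
  dom-zip []      []      = refl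
  dom-zip (v ∷ x) (w ∷ y) = cong₂ _∷_ (quotient-X v w) (dom-zip x y)

  cod-zip : (x : Tuple true n) (y : Tuple false n) → cod (Vec.zipWith X x y) ≡ y
  cod-zip []      []      = refl
  cod-zip (v ∷ x) (w ∷ y) = cong₂ _∷_ (remainder-X v w) (cod-zip x y)

  L : Vec (Fin N) n → ℚ
  L ts = ℓ (dom ts) (cod ts)

  L-∷ : ∀ v w (ts : Vec (Fin N) n) → L (X v w ∷ ts) ≡ ℓ (v ∷ dom ts) (w ∷ cod ts)
  L-∷ v w ts = cong₂ (λ a b → ℓ (a ∷ dom ts) (b ∷ cod ts)) (quotient-X v w) (remainder-X v w)

  L-⊆ : n ≤ M → m ≤ M → {ts : Vec (Fin N) n} {us : Vec (Fin N) m} →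
        ts ⊆ᵛ us → us ⊆ᵛ ts → L ts ≡ L us
  L-⊆ n≤ m≤ p q = ℓ-⊑ n≤ m≤ (map-⊑ _ _ p) (map-⊑ _ _ q)

  open Functional (subsets N) ∣_∣ (λ S → dom (elements S)) (λ S → cod (elements S))

  -- The pseudo-expectation of p times the product of `ts`. The list may repeat variables and share
  -- them with the monomials of p; `L-⊆` absorbs this.
  E[_] : Poly N → Vec (Fin N) n → ℚ
  E[ p ] ts = ∑ (subsets N) (λ S → p S * L (ts ++ elements S))

  E≡F : ∀ p (ts : Vec (Fin N) n) → E[ p ] ts ≡ F p (dom ts) (cod ts)
  E≡F p ts = ∑-cong (subsets N) λ S → cong₂ (λ a b → p S * ℓ a b)
    (Vec.map-++ _ ts (elements S)) (Vec.map-++ _ ts (elements S))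

  E-cong : ∀ {p q} → p ≈ q → (ts : Vec (Fin N) n) → E[ p ] ts ≡ E[ q ] ts
  E-cong p≈q ts = ∑-cong (subsets N) λ S → cong (_* L (ts ++ elements S)) (p≈q S)

  E-lin : ∀ a b p q (ts : Vec (Fin N) n) →
          E[ (a · p) +ₚ (b · q) ] ts ≡ a * E[ p ] ts + b * E[ q ] ts
  E-lin a b p q ts = begin
    ∑ (subsets N) (λ S → (a * p S + b * q S) * L (ts ++ elements S))
      ≡⟨ ∑-cong (subsets N) (λ S → expand a (p S) b (q S) (L (ts ++ elements S))) ⟩
    ∑ (subsets N) (λ S → a * (p S * L (ts ++ elements S)) + b * (q S * L (ts ++ elements S)))
      ≡⟨ ∑-+ (subsets N) _ _ ⟩
    ∑ (subsets N) (λ S → a * (p S * L (ts ++ elements S))) +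
    ∑ (subsets N) (λ S → b * (q S * L (ts ++ elements S)))
      ≡⟨ cong₂ _+_ (∑-*ˡ (subsets N) a _) (∑-*ˡ (subsets N) b _) ⟩
    a * E[ p ] ts + b * E[ q ] ts ∎
    where
    open +-*-Solver
    expand : ∀ a x b y z → (a * x + b * y) * z ≡ a * (x * z) + b * (y * z)
    expand = solve 5 (λ a x b y z → (a :* x :+ b :* y) :* z := a :* (x :* z) :+ b :* (y :* z)) refl

  E-difference : ∀ p q (ts : Vec (Fin N) n) → E[ p ] ts ≡ E[ q ] ts → E[ p -ₚ q ] ts ≡ 0ℚ
  E-difference p q ts p≡q = begin
    E[ p -ₚ q ] ts
      ≡⟨ E-cong (λ S → difference (p S) (q S)) ts ⟩
    E[ (1ℚ · p) +ₚ ((ℚ.- 1ℚ) · q) ] ts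
      ≡⟨ E-lin 1ℚ (ℚ.- 1ℚ) p q ts ⟩
    1ℚ * E[ p ] ts + (ℚ.- 1ℚ) * E[ q ] ts
      ≡⟨ cong (λ c → 1ℚ * c + (ℚ.- 1ℚ) * E[ q ] ts) p≡q ⟩
    1ℚ * E[ q ] ts + (ℚ.- 1ℚ) * E[ q ] ts
      ≡⟨ difference (E[ q ] ts) (E[ q ] ts) ⟨
    E[ q ] ts ℚ.- E[ q ] ts
      ≡⟨ ℚ.+-inverseʳ (E[ q ] ts) ⟩
    0ℚ ∎
    where
    difference : ∀ x y → x ℚ.- y ≡ 1ℚ * x + (ℚ.- 1ℚ) * y
    difference x y = cong₂ _+_ (sym (ℚ.*-identityˡ x))
      (trans (cong ℚ.-_ (sym (ℚ.*-identityˡ y))) (ℚ.neg-distribˡ-* 1ℚ y))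

  E-sum : ∀ {j} (f : Fin j → Poly N) (ts : Vec (Fin N) n) →
          E[ sumₚ f ] ts ≡ ∑ (allFin j) (λ i → E[ f i ] ts)
  E-sum {j = zero}  f ts = ∑-zero (subsets N) λ S → ℚ.*-zeroˡ (L (ts ++ elements S))
  E-sum {j = suc j} f ts = begin
    ∑ (subsets N) (λ S → (f zero S + sumₚ (f ∘ suc) S) * L (ts ++ elements S))
      ≡⟨ trans (∑-cong (subsets N) λ S →
             ℚ.*-distribʳ-+ (L (ts ++ elements S)) (f zero S) (sumₚ (f ∘ suc) S))
           (∑-+ (subsets N) _ _) ⟩
    E[ f zero ] ts + E[ sumₚ (f ∘ suc) ] ts
      ≡⟨ cong (E[ f zero ] ts +_) (E-sum (f ∘ suc) ts) ⟩
    E[ f zero ] ts + ∑ (allFin j) (λ i → E[ f (suc i) ] ts)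
      ≡⟨ ∑-allFin-suc j (λ i → E[ f i ] ts) ⟨
    ∑ (allFin (suc j)) (λ i → E[ f i ] ts) ∎

  E-monomial : ∀ S (ts : Vec (Fin N) n) → E[ monomial S ] ts ≡ L (ts ++ elements S)
  E-monomial S ts = begin
    ∑ (subsets N) (λ T → 𝟙 (S ≟ T) * L (ts ++ elements T))
      ≡⟨ vecs-deltas bools-deltas N _ S (λ T T≢S → trans
           (cong (_* L (ts ++ elements T)) (𝟙-false (S ≟ T) (T≢S ∘ sym)))
           (ℚ.*-zeroˡ (L (ts ++ elements T)))) ⟩
    𝟙 (S ≟ S) * L (ts ++ elements S)
      ≡⟨ trans (cong (_* L (ts ++ elements S)) (𝟙-true (S ≟ S) refl)) (ℚ.*-identityˡ _) ⟩
    L (ts ++ elements S) ∎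
    where
    _≟_ : (S T : Subset N) → Dec (S ≡ T)
    _≟_ = Vec.≡-dec Bool._≟_

  E-1 : n ≤ M → (ts : Vec (Fin N) n) → E[ 1ₚ ] ts ≡ L ts
  E-1 {n} n≤M ts = trans (E-monomial Subset.⊥ ts) (L-⊆ n+0≤M n≤M ⊆₁ ∈-++⁺ˡ)
    where
    n+0≤M : n ℕ.+ ∣ Subset.⊥ {N} ∣ ≤ M
    n+0≤M rewrite ∣⊥∣≡0 N | ℕ.+-identityʳ n = n≤M
    ⊆₁ : (ts ++ elements Subset.⊥) ⊆ᵛ ts
    ⊆₁ p with VecAny.++⁻ ts p
    ... | inj₁ q = q
    ... | inj₂ q = contradiction (∈-elements⁻ q) ∉⊥

  E-var : suc n ≤ M → ∀ x (ts : Vec (Fin N) n) → E[ var x ] ts ≡ L (x ∷ ts)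
  E-var {n} n<M x ts = trans (E-monomial ⁅ x ⁆ ts) (L-⊆ n+1≤M n<M ⊆₁ ⊆₂)
    where
    n+1≤M : n ℕ.+ ∣ ⁅ x ⁆ ∣ ≤ M
    n+1≤M rewrite ∣⁅x⁆∣≡1 x | ℕ.+-comm n 1 = n<M
    ⊆₁ : (ts ++ elements ⁅ x ⁆) ⊆ᵛ (x ∷ ts)
    ⊆₁ p with VecAny.++⁻ ts p
    ... | inj₁ q = VecAny.there q
    ... | inj₂ q = VecAny.here (x∈⁅y⁆⇒x≡y x (∈-elements⁻ q))
    ⊆₂ : (x ∷ ts) ⊆ᵛ (ts ++ elements ⁅ x ⁆)
    ⊆₂ (VecAny.here refl) = ∈-++⁺ʳ ts (∈-elements⁺ (x∈⁅x⁆ x))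
    ⊆₂ (VecAny.there q)   = ∈-++⁺ˡ q

  var-degree : ∀ x → Degree≤ 1 (var {N} x)
  var-degree x S h with Vec.≡-dec Bool._≟_ ⁅ x ⁆ S
  ... | yes refl = ℕ.≤-reflexive (∣⁅x⁆∣≡1 x)
  ... | no _     = contradiction refl h

  -- Moves the factor x from the polynomial into the test monomial: for each S in the support, both
  -- sides list the same set of variables.
  E-∙ : ∀ {p} → Degree≤ k p → n ℕ.+ suc k ≤ M → ∀ x (ts : Vec (Fin N) n) →
        E[ x ∙ p ] ts ≡ E[ p ] (x ∷ ts)
  E-∙ {k} {n} {p} deg bound x ts =
    trans (∑-∙ x p (λ S → L (ts ++ elements S))) (∑-cong (subsets N) λ S → *-cong-≢0 λ pS →
      L-⊆ (ℕ.≤-trans (ℕ.+-monoʳ-≤ n (ℕ.≤-trans (∣p∪⁅x⁆∣≤1+∣p∣ S x) (s≤s (deg S pS)))) bound)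
          (ℕ.≤-trans (ℕ.≤-reflexive (sym (ℕ.+-suc n ∣ S ∣)))
                     (ℕ.≤-trans (ℕ.+-monoʳ-≤ n (s≤s (deg S pS))) bound))
          (⊆₁ S) (⊆₂ S))
    where
    ⊆₁ : ∀ S → (ts ++ elements (S ∪ ⁅ x ⁆)) ⊆ᵛ (x ∷ ts ++ elements S)
    ⊆₁ S h with VecAny.++⁻ ts h
    ... | inj₁ q = VecAny.there (∈-++⁺ˡ q)
    ... | inj₂ q with x∈p∪q⁻ S ⁅ x ⁆ (∈-elements⁻ {S = S ∪ ⁅ x ⁆} q)
    ...   | inj₁ r = VecAny.there (∈-++⁺ʳ ts (∈-elements⁺ r))
    ...   | inj₂ r = VecAny.here (x∈⁅y⁆⇒x≡y x r)
    ⊆₂ : ∀ S → (x ∷ ts ++ elements S) ⊆ᵛ (ts ++ elements (S ∪ ⁅ x ⁆))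
    ⊆₂ S (VecAny.here refl) = ∈-++⁺ʳ ts (∈-elements⁺ {S = S ∪ ⁅ x ⁆} (x∈p∪q⁺ (inj₂ (x∈⁅x⁆ x))))
    ⊆₂ S (VecAny.there h) with VecAny.++⁻ ts h
    ... | inj₁ q = ∈-++⁺ˡ q
    ... | inj₂ q = ∈-++⁺ʳ ts (∈-elements⁺ {S = S ∪ ⁅ x ⁆} (x∈p∪q⁺ (inj₁ (∈-elements⁻ {S = S} q))))

  E-∙-var : suc (suc n) ≤ M → ∀ x y (ts : Vec (Fin N) n) → E[ x ∙ var y ] ts ≡ L (y ∷ x ∷ ts)
  E-∙-var {n} bound x y ts =
    trans (E-∙ (var-degree y) (subst (_≤ M) (ℕ.+-comm 2 n) bound) x ts) (E-var bound y (x ∷ ts))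

  -- The axioms are at most quadratic, so two entries beyond `ts` suffice. The row and column
  -- equations are marginals of ℓ; the Boolean ones hold because ℓ ignores repetitions.
  ISO-vanishes : suc (suc n) ≤ M → ∀ {p} → ISO G H p → (ts : Vec (Fin N) n) → E[ p ] ts ≡ 0ℚ
  ISO-vanishes {n} bound iso ts with iso
  ... | boolean v w = E-difference (X v w ∙ var (X v w)) (var (X v w)) ts (begin
    E[ X v w ∙ var (X v w) ] ts  ≡⟨ E-∙-var bound (X v w) (X v w) ts ⟩
    L (X v w ∷ X v w ∷ ts)       ≡⟨ L-⊆ bound (ℕ.<⇒≤ bound)
                                      (λ { (VecAny.here refl) → VecAny.here refl ; (VecAny.there q) → q }) VecAny.there ⟩
    L (X v w ∷ ts)               ≡⟨ E-var (ℕ.<⇒≤ bound) (X v w) ts ⟨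
    E[ var (X v w) ] ts          ∎)
  ... | row v = E-difference (sumₚ λ w → var (X v w)) 1ₚ ts (begin
    E[ sumₚ (λ w → var (X v w)) ] ts
      ≡⟨ E-sum (λ w → var (X v w)) ts ⟩
    ∑ (vertices false) (λ w → E[ var (X v w) ] ts)
      ≡⟨ ∑-cong (vertices false) (λ w → trans (E-var (ℕ.<⇒≤ bound) (X v w) ts) (L-∷ v w ts)) ⟩
    ∑ (vertices false) (λ w → ℓ (v ∷ dom ts) (w ∷ cod ts))
      ≡⟨ ℓ-row (ℕ.<⇒≤ bound) (dom ts) (cod ts) v ⟩
    L ts
      ≡⟨ E-1 (ℕ.<⇒≤ (ℕ.<⇒≤ bound)) ts ⟨
    E[ 1ₚ ] ts ∎)
  ... | column w = E-difference (sumₚ λ v → var (X v w)) 1ₚ ts (begin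
    E[ sumₚ (λ v → var (X v w)) ] ts
      ≡⟨ E-sum (λ v → var (X v w)) ts ⟩
    ∑ (vertices true) (λ v → E[ var (X v w) ] ts)
      ≡⟨ ∑-cong (vertices true) (λ v → trans (E-var (ℕ.<⇒≤ bound) (X v w) ts) (L-∷ v w ts)) ⟩
    ∑ (vertices true) (λ v → ℓ (v ∷ dom ts) (w ∷ cod ts))
      ≡⟨ ℓ-column (ℕ.<⇒≤ bound) (dom ts) (cod ts) w ⟩
    L ts
      ≡⟨ E-1 (ℕ.<⇒≤ (ℕ.<⇒≤ bound)) ts ⟨
    E[ 1ₚ ] ts ∎)
  ... | compat v₁ v₂ w₁ w₂ v⇔¬w = begin
    E[ X v₁ w₁ ∙ var (X v₂ w₂) ] ts
      ≡⟨ E-∙-var bound (X v₁ w₁) (X v₂ w₂) ts ⟩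
    L (X v₂ w₂ ∷ X v₁ w₁ ∷ ts)
      ≡⟨ 𝟙-false≁ ⟩
    0ℚ ∎
    where
    edge⇔ : dom (X v₂ w₂ ∷ X v₁ w₁ ∷ ts) ~ cod (X v₂ w₂ ∷ X v₁ w₁ ∷ ts) →
            (Edge G v₁ v₂ → Edge H w₁ w₂) × (Edge H w₁ w₂ → Edge G v₁ v₂)
    edge⇔ r =
      -- The factor `X v₁ w₁` was moved into the test monomial first, so position 1 carries v₁ and
      -- w₁ and position 0 carries v₂ and w₂.
      (λ h → subst₂ (Edge H) (remainder-X v₁ w₁) (remainder-X v₂ w₂) (~-edge r (suc zero) zero
        (subst₂ (Edge G) (sym (quotient-X v₁ w₁)) (sym (quotient-X v₂ w₂)) h))) ,
      (λ h → subst₂ (Edge G) (quotient-X v₁ w₁) (quotient-X v₂ w₂) (~-edge (~-sym r) (suc zero) zero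
        (subst₂ (Edge H) (sym (remainder-X v₁ w₁)) (sym (remainder-X v₂ w₂)) h)))
    ≁ : ¬ (dom (X v₂ w₂ ∷ X v₁ w₁ ∷ ts) ~ cod (X v₂ w₂ ∷ X v₁ w₁ ∷ ts))
    -- Together with `v⇔¬w`, equivalence of the tuples would make an edge of H equivalent to its own
    -- negation.
    ≁ r = ¬w (proj₁ (edge⇔ r) (from v⇔¬w ¬w))
      where
      ¬w : ¬ Edge H w₁ w₂
      ¬w h = to v⇔¬w (proj₂ (edge⇔ r) h) h
    𝟙-false≁ : L (X v₂ w₂ ∷ X v₁ w₁ ∷ ts) ≡ 0ℚ
    𝟙-false≁ = trans
      (cong (_* inv (classSize (cod (X v₂ w₂ ∷ X v₁ w₁ ∷ ts))))
        (𝟙-false (dom (X v₂ w₂ ∷ X v₁ w₁ ∷ ts) ~? cod (X v₂ w₂ ∷ X v₁ w₁ ∷ ts)) ≁))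
      (ℚ.*-zeroˡ (inv (classSize (cod (X v₂ w₂ ∷ X v₁ w₁ ∷ ts)))))

  Vanishes : ℕ → Poly N → Set
  Vanishes k p = ∀ {n} → n ≤ k → (ts : Vec (Fin N) n) → E[ p ] ts ≡ 0ℚ

  -- Regains the degree of test monomials that a multiplication uses up. By `dom-zip` and `cod-zip`
  -- every pair of tuples comes from a list of variables, so the hypothesis covers all of them.
  vanishes-suc : ∀ {p} → suc k ℕ.+ (k ℕ.+ k) ≤ M → Degree≤ k p → Vanishes k p → Vanishes (suc k) p
  vanishes-suc {k} {p} bound deg vanishes n≤ ts = trans (E≡F p ts)
    (vanishing-extends p deg
      (λ d≤k x y → trans (sym (cong₂ (F p) (dom-zip x y) (cod-zip x y)))
                         (trans (sym (E≡F p (Vec.zipWith X x y))) (vanishes d≤k _)))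
      (ℕ.≤-trans (ℕ.+-monoˡ-≤ (k ℕ.+ k) n≤) bound) (dom ts) (cod ts))

  Degree-lin : ∀ a b {p q : Poly N} → Degree≤ k p → Degree≤ k q → Degree≤ k ((a · p) +ₚ (b · q))
  Degree-lin a b {p} {q} degp degq S h with p S ℚ.≟ 0ℚ | q S ℚ.≟ 0ℚ
  ... | no pS   | _       = degp S pS
  ... | yes _   | no qS   = degq S qS
  ... | yes p≡0 | yes q≡0 = contradiction
    (trans (cong₂ (λ x y → a * x + b * y) p≡0 q≡0)
           (cong₂ _+_ (ℚ.*-zeroʳ a) (ℚ.*-zeroʳ b))) h

  module _ (bound : suc k ℕ.+ (k ℕ.+ k) ≤ M) (bound₂ : suc (suc k) ≤ M) where

    -- The degree bound is part of the invariant because `vanishes-suc` is applied to the premise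
    -- `g` of a multiplication and needs its degree, not that of `x ∙ g`.
    derivable⇒vanishes : ∀ {p} → PC k (ISO G H) p → Degree≤ k p × Vanishes k p
    derivable⇒vanishes (axiom iso deg) =
      deg , λ n≤k → ISO-vanishes (ℕ.≤-trans (s≤s (s≤s n≤k)) bound₂) iso
    derivable⇒vanishes (mult {g} x d deg) with degg , vang ← derivable⇒vanishes d =
      deg , λ {n} n≤k ts → trans
        (E-∙ degg (ℕ.≤-trans (ℕ.+-monoˡ-≤ (suc k) n≤k)
          (ℕ.≤-trans (ℕ.≤-reflexive (ℕ.+-suc k k)) (ℕ.≤-trans (s≤s (ℕ.m≤n+m (k ℕ.+ k) k)) bound))) x ts)
        (vanishes-suc bound degg vang (s≤s n≤k) (x ∷ ts))
    derivable⇒vanishes (lin {g} {h} a b d₁ d₂)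
      with degg , vang ← derivable⇒vanishes d₁ | degh , vanh ← derivable⇒vanishes d₂ =
      Degree-lin a b degg degh , λ n≤k ts → trans (E-lin a b g h ts)
        (trans (cong₂ (λ x y → a * x + b * y) (vang n≤k ts) (vanh n≤k ts))
               (cong₂ _+_ (ℚ.*-zeroʳ a) (ℚ.*-zeroʳ b)))
    derivable⇒vanishes (resp {g} {h} g≈h d) with degg , vang ← derivable⇒vanishes d =
      (λ S hS → degg S (hS ∘ trans (sym (g≈h S)))) ,
      λ n≤k ts → trans (sym (E-cong g≈h ts)) (vang n≤k ts)

    irrefutable : ¬ Refutation k (ISO G H)
    irrefutable d with () ← trans (sym (trans (E-1 z≤n []) ℓ-unit)) (proj₂ (derivable⇒vanishes d) z≤n [])

-- M = 3k + 2 exceeds by one the length 3k + 1 of a test tuple of length k + 1 joined to two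
-- monomials of degree k, and for every k it also leaves room for k + 2, a test monomial times a
-- quadratic axiom. One more variable is the quantified one of the refinement.
≡C⇒irrefutable : ∀ k (G H : Graph) → G ≡C[ suc (3 ℕ.* k ℕ.+ 2) ] H → ¬ Refutation k (ISO G H)
≡C⇒irrefutable k G H G≡H = Soundness.irrefutable stableEquivalence linked
  (ℕ.≤-trans (ℕ.n≤1+n _) (ℕ.≤-reflexive (sym M≡)))
  (ℕ.≤-trans (s≤s (s≤s (ℕ.m≤m+n k (k ℕ.+ k)))) (ℕ.≤-reflexive (sym M≡)))
  where
  𝒢 : Bool → Graph
  𝒢 b = if b then G else H
  M≡ : 3 ℕ.* k ℕ.+ 2 ≡ suc (suc (k ℕ.+ (k ℕ.+ k)))
  M≡ = trans (ℕ.+-comm (3 ℕ.* k) 2) (cong (λ j → 2 ℕ.+ (k ℕ.+ (k ℕ.+ j))) (ℕ.+-identityʳ k))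
  open Stabilisation 𝒢 (3 ℕ.* k ℕ.+ 2)
  linked : ∀ s t → StableEquivalence._~_ stableEquivalence {s} {t} [] []
  linked true  true  = StableEquivalence.~-refl stableEquivalence {true}
  linked true  false = indistinguishable⇒[]~[] {true} {false} λ (φ , sat , ¬sat) →
    G≡H (φ , inj₁ (sat , ¬sat))
  linked false true  = indistinguishable⇒[]~[] {false} {true} λ (φ , sat , ¬sat) →
    G≡H (φ , inj₂ (sat , ¬sat))
  linked false false = StableEquivalence.~-refl stableEquivalence {false}

theorem6p6 : ∃[ f ] (IsLinear f × (∀ (k : ℕ) → 2 ≤ k → ∀ (G H : Graph) → G ≢PC[ k ] H → G ≢C[ f k ] H))
theorem6p6 = (λ k → suc (3 ℕ.* k ℕ.+ 2)) , (3 , 3 , λ k → sym (ℕ.+-suc (3 ℕ.* k) 2)) ,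
  λ k _ G H refutation G≡H → ≡C⇒irrefutable k G H G≡H refutation
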